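{- There is an absolute constant $c>0$ such that the following holds. Let $n\ge2$ and $d\ge1$ be integers such that for every $0\le w\le n$ there exists a symmetric torus polynomial $Q_w:\{0,1\}^n\to\mathbb{T}$ of degree $d$ that $\frac{1}{20n}$-approximates $\Delta_w$. Then $d\ge c\sqrt{\frac{n}{\log n}}$.
   Context: Let $\mathbb{T}=\mathbb{R}/\mathbb{Z}$. For $z\in\mathbb{T}$, $|z \bmod 1|$ denotes $|\iota(z)|$, where $\iota(z)$ is the unique representative of $z$ in $[-1/2,1/2)$. For $F:\{0,1\}^n\to\mathbb{T}$, $\|F \bmod 1\|_\infty=\max_{x\in\{0,1\}^n}|F(x)\bmod 1|$. A torus polynomial of degree (at most) $d$ is a function $P:\{0,1\}^n\to\mathbb{T}$ of the form $P(x)=\sum_{S\subseteq[n],|S|\le d}P_S\prod_{i\in S}x_i \bmod 1$ with $P_S\in\mathbb{R}$. It is symmetric if it is given by a symmetric real polynomial of degree at most $d$ evaluated modulo one (i.e. the coefficients $P_S$ can be taken to depend only on $|S|$). It $\varepsilon$-approximates $f:\{0,1\}^n\to\{0,1\}$ if $\|P-\tfrac{f}{2}\bmod 1\|_\infty\le\varepsilon$. For $x\in\{0,1\}^n$, $|x|=\sum_i x_i$. For $0\le w\le n$, $\Delta_w:\{0,1\}^n\to\{0,1\}$ is defined by $\Delta_w(x)=1$ if $|x|=w$ and $0$ otherwise. -}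

module Defs where

open import Data.Bool.Base using (Bool; true; false)
open import Data.Integer.Base as ℤ using (ℤ; +_)
import Data.Integer.Properties as ℤP
open import Data.List.Base as List using (List; []; _∷_; _++_)
open import Data.Nat.Base as ℕ using (ℕ; zero; suc; z≤n; s≤s)
import Data.Nat.DivMod as ℕDM
open import Data.Nat.Induction using (<-rec)
open import Data.Nat.Logarithm
  using (⌊log₂_⌋; ⌊log₂⌋-mono-≤; ⌊log₂⌊n/2⌋⌋≡⌊log₂n⌋∸1; ⌊log₂[2^n]⌋≡n)
import Data.Nat.Properties as ℕP
open import Data.Product.Base using (∃-syntax; Σ-syntax; _×_; _,_; proj₁; proj₂)
open import Data.Rational.Base as ℚ using (ℚ; 0ℚ; 1ℚ; mkℚ)
import Data.Rational.Properties as ℚP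
open import Data.Rational.Solver using (module +-*-Solver)
import Data.Rational.Unnormalised.Base as ℚᵘ
import Data.Rational.Unnormalised.Properties as ℚᵘP
open import Data.Fin.Subset using (Subset; inside; outside) renaming (∣_∣ to card)
open import Data.Sum.Base using (inj₁; inj₂)
open import Data.Vec.Base as Vec using (Vec; []; _∷_)
open import Relation.Binary.PropositionalEquality
  using (_≡_; refl; sym; trans; cong; cong₂; subst; subst₂)
open import Relation.Nullary.Decidable.Core using (does; yes; no)
open import Relation.Nullary.Negation using (contradiction)

private open module S = +-*-Solver using (solve; _:+_; _:*_; :-_; _:-_; _:=_; con)

½* : ℚ → ℚ
½* ε = ℚ.½ ℚ.* ε

½*-pos : ∀ {ε} → 0ℚ ℚ.< ε → 0ℚ ℚ.< ½* ε
½*-pos {ε} 0<ε = ℚP.positive⁻¹ (½* ε) {{ℚP.pos*pos⇒pos ℚ.½ ε {{ℚ.positive 0<ε}}}}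

½+½ : ∀ ε → ½* ε ℚ.+ ½* ε ≡ ε
½+½ = solve 1 (λ e → con ℚ.½ :* e :+ con ℚ.½ :* e := e) refl

+-shuffle : ∀ a b e → (a ℚ.+ e) ℚ.+ (b ℚ.+ e) ≡ (a ℚ.+ b) ℚ.+ (e ℚ.+ e)
+-shuffle = solve 3 (λ a b e → (a :+ e) :+ (b :+ e) := (a :+ b) :+ (e :+ e)) refl

neg-swapˡ : ∀ a b → b ℚ.+ (ℚ.- a ℚ.- b) ≡ ℚ.- a
neg-swapˡ = solve 2 (λ a b → b :+ (:- a :- b) := :- a) refl

neg-swapʳ : ∀ a b e → (a ℚ.+ e) ℚ.+ (ℚ.- a ℚ.- b) ≡ ℚ.- b ℚ.+ e
neg-swapʳ = solve 3 (λ a b e → (a :+ e) :+ (:- a :- b) := :- b :+ e) refl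

+-∸-cancel : ∀ a b → a ℚ.+ (b ℚ.- a) ≡ b
+-∸-cancel = solve 2 (λ a b → a :+ (b :- a) := b) refl

*-split : ∀ a b c d → (a ℚ.- c) ℚ.* b ℚ.+ (b ℚ.- d) ℚ.* c ≡ a ℚ.* b ℚ.- c ℚ.* d
*-split = solve 4 (λ a b c d →
  (a :- c) :* b :+ (b :- d) :* c := a :* b :- c :* d) refl

recip-split : ∀ i a b e →
  (i ℚ.+ e) ℚ.* (a ℚ.* b) ≡ (i ℚ.* b) ℚ.* a ℚ.+ e ℚ.* (a ℚ.* b)
recip-split = solve 4 (λ i a b e →
  (i :+ e) :* (a :* b) := (i :* b) :* a :+ e :* (a :* b)) refl

∸⇒≤ : ∀ {a b c} → a ℚ.- b ℚ.≤ c → a ℚ.≤ b ℚ.+ c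
∸⇒≤ {a} {b} {c} h = subst (ℚ._≤ b ℚ.+ c)
  (+-∸-cancel b a) (ℚP.+-monoʳ-≤ b h)

≤⇒∸ : ∀ {a b c} → a ℚ.≤ b ℚ.+ c → a ℚ.- b ℚ.≤ c
≤⇒∸ {a} {b} {c} h = subst (a ℚ.- b ℚ.≤_)
  (solve 2 (λ b c → (b :+ c) :- b := c) refl b c) (ℚP.+-monoˡ-≤ (ℚ.- b) h)

infix 4 _≤_ _<_ _≃_
infixl 6 _+_ _-_ _⊔_
infixl 7 _*_
infix 8 -_

-- Real numbers as Cauchy sequences of rationals.  Exchanging m and n turns the
-- one-sided bound into |seq m - seq n| ≤ ε.
record ℝ : Set where
  constructor mkℝ
  field
    seq    : ℕ → ℚ
    cauchy : ∀ ε → 0ℚ ℚ.< ε →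
             ∃[ N ] (∀ m n → N ℕ.≤ m → N ℕ.≤ n → seq m ℚ.≤ seq n ℚ.+ ε)

open ℝ public

_≤_ : ℝ → ℝ → Set
x ≤ y = ∀ ε → 0ℚ ℚ.< ε → ∃[ N ] (∀ m → N ℕ.≤ m → seq x m ℚ.≤ seq y m ℚ.+ ε)

_<_ : ℝ → ℝ → Set
x < y = ∃[ ε ] (0ℚ ℚ.< ε × ∃[ N ] (∀ m → N ℕ.≤ m → seq x m ℚ.+ ε ℚ.≤ seq y m))

_≃_ : ℝ → ℝ → Set
x ≃ y = x ≤ y × y ≤ x

fromℚ : ℚ → ℝ
fromℚ q = mkℝ (λ _ → q) λ ε 0<ε → 0 , λ _ _ _ _ →
  subst (ℚ._≤ q ℚ.+ ε) (ℚP.+-identityʳ q) (ℚP.+-monoʳ-≤ q (ℚP.<⇒≤ 0<ε))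

fromℤ : ℤ → ℝ
fromℤ i = fromℚ (i ℚ./ 1)

fromℕ : ℕ → ℝ
fromℕ n = fromℤ (+ n)

0ℝ : ℝ
0ℝ = fromℚ 0ℚ

_+_ : ℝ → ℝ → ℝ
seq (x + y) m = seq x m ℚ.+ seq y m
cauchy (x + y) ε 0<ε with cauchy x (½* ε) (½*-pos 0<ε) | cauchy y (½* ε) (½*-pos 0<ε)
... | M , hx | N , hy = M ℕ.⊔ N , λ m n p q →
  subst (seq x m ℚ.+ seq y m ℚ.≤_)
    (trans (+-shuffle (seq x n) (seq y n) (½* ε))
           (cong (seq x n ℚ.+ seq y n ℚ.+_) (½+½ ε)))
    (ℚP.+-mono-≤ (hx m n (ℕP.m⊔n≤o⇒m≤o M N p) (ℕP.m⊔n≤o⇒m≤o M N q))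
                 (hy m n (ℕP.m⊔n≤o⇒n≤o M N p) (ℕP.m⊔n≤o⇒n≤o M N q)))

-_ : ℝ → ℝ
seq (- x) m = ℚ.- seq x m
cauchy (- x) ε 0<ε with cauchy x ε 0<ε
... | N , h = N , λ m n p q →
  subst₂ ℚ._≤_
    (neg-swapˡ (seq x m) (seq x n))
    (neg-swapʳ (seq x m) (seq x n) ε)
    (ℚP.+-monoˡ-≤ (ℚ.- seq x m ℚ.- seq x n) (h n m q p))

_-_ : ℝ → ℝ → ℝ
x - y = x + (- y)

_⊔_ : ℝ → ℝ → ℝ
seq (x ⊔ y) m = seq x m ℚ.⊔ seq y m
cauchy (x ⊔ y) ε 0<ε with cauchy x ε 0<ε | cauchy y ε 0<ε
... | M , hx | N , hy = M ℕ.⊔ N , λ m n p q →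
  ℚP.⊔-lub
    (ℚP.≤-trans (hx m n (ℕP.m⊔n≤o⇒m≤o M N p) (ℕP.m⊔n≤o⇒m≤o M N q))
                (ℚP.+-monoˡ-≤ ε (ℚP.p≤p⊔q (seq x n) (seq y n))))
    (ℚP.≤-trans (hy m n (ℕP.m⊔n≤o⇒n≤o M N p) (ℕP.m⊔n≤o⇒n≤o M N q))
                (ℚP.+-monoˡ-≤ ε (ℚP.p≤q⊔p (seq x n) (seq y n))))

∣_∣ : ℝ → ℝ
∣ x ∣ = x ⊔ (- x)

∣∣≤ : ∀ {a b e} → a ℚ.≤ b ℚ.+ e → b ℚ.≤ a ℚ.+ e → ℚ.∣ a ℚ.- b ∣ ℚ.≤ e
∣∣≤ {a} {b} {e} h k with ℚP.∣p∣≡p∨∣p∣≡-p (a ℚ.- b)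
... | inj₁ eq = subst (ℚ._≤ e) (sym eq) (≤⇒∸ h)
... | inj₂ eq = subst (ℚ._≤ e)
  (trans (solve 2 (λ a b → b :- a := :- (a :- b)) refl a b) (sym eq)) (≤⇒∸ k)

p≤∣p∣ : ∀ p → p ℚ.≤ ℚ.∣ p ∣
p≤∣p∣ p with ℚP.≤-total 0ℚ p
... | inj₁ 0≤p = ℚP.≤-reflexive (sym (ℚP.0≤p⇒∣p∣≡p 0≤p))
... | inj₂ p≤0 = ℚP.≤-trans p≤0 (ℚP.0≤∣p∣ p)

*≤*∣∣ : ∀ {a b c d} → ℚ.∣ a ∣ ℚ.≤ c → ℚ.∣ b ∣ ℚ.≤ d → a ℚ.* b ℚ.≤ c ℚ.* d
*≤*∣∣ {a} {b} {c} {d} h k = ℚP.≤-trans (p≤∣p∣ (a ℚ.* b))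
  (subst (ℚ._≤ c ℚ.* d) (sym (ℚP.∣p*q∣≡∣p∣*∣q∣ a b))
    (ℚP.≤-trans
      (ℚP.*-monoʳ-≤-nonNeg ℚ.∣ b ∣ {{ℚP.∣-∣-nonNeg b}} h)
      (ℚP.*-monoˡ-≤-nonNeg c
        {{ℚ.nonNegative (ℚP.≤-trans (ℚP.0≤∣p∣ a) h)}} k)))

bounded : ∀ x → ∃[ K ] (0ℚ ℚ.< K × ∃[ N ] (∀ m → N ℕ.≤ m → ℚ.∣ seq x m ∣ ℚ.≤ K))
bounded x with cauchy x 1ℚ (ℚP.positive⁻¹ 1ℚ)
... | N , h = ℚ.∣ a ∣ ℚ.+ 1ℚ , pos , N , bound
  where
  a = seq x N
  pos : 0ℚ ℚ.< ℚ.∣ a ∣ ℚ.+ 1ℚ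
  pos = ℚP.+-mono-≤-< (ℚP.0≤∣p∣ a) (ℚP.positive⁻¹ 1ℚ)
  bound : ∀ m → N ℕ.≤ m → ℚ.∣ seq x m ∣ ℚ.≤ ℚ.∣ a ∣ ℚ.+ 1ℚ
  bound m p = ℚP.≤-trans
    (subst (λ t → ℚ.∣ t ∣ ℚ.≤ ℚ.∣ a ∣ ℚ.+ ℚ.∣ seq x m ℚ.- a ∣)
      (+-∸-cancel a (seq x m))
      (ℚP.∣p+q∣≤∣p∣+∣q∣ a (seq x m ℚ.- a)))
    (ℚP.+-monoʳ-≤ ℚ.∣ a ∣ (∣∣≤ (h m N p ℕP.≤-refl) (h N m ℕP.≤-refl p)))

_÷⁺_ : ∀ ε {K} → 0ℚ ℚ.< K → ℚ
_÷⁺_ ε {K} 0<K = ε ℚ.* (ℚ.1/ K) {{ℚ.>-nonZero 0<K}}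

÷⁺-pos : ∀ {ε K} → 0ℚ ℚ.< ε → (0<K : 0ℚ ℚ.< K) → 0ℚ ℚ.< ε ÷⁺ 0<K
÷⁺-pos {ε} {K} 0<ε 0<K = ℚP.positive⁻¹ _
  {{ℚP.pos*pos⇒pos ε {{ℚ.positive 0<ε}} _ {{ℚP.1/pos⇒pos K {{ℚ.positive 0<K}}}}}}

÷⁺-* : ∀ ε {K} (0<K : 0ℚ ℚ.< K) → (ε ÷⁺ 0<K) ℚ.* K ≡ ε
÷⁺-* ε {K} 0<K = trans (ℚP.*-assoc ε _ K)
  (trans (cong (ε ℚ.*_) (ℚP.*-inverseˡ K {{ℚ.>-nonZero 0<K}})) (ℚP.*-identityʳ ε))

*-lipschitz : ∀ a b c d {ε K L} (0<K : 0ℚ ℚ.< K) (0<L : 0ℚ ℚ.< L) →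
              ℚ.∣ b ∣ ℚ.≤ L → ℚ.∣ c ∣ ℚ.≤ K →
              ℚ.∣ a ℚ.- c ∣ ℚ.≤ ½* ε ÷⁺ 0<L → ℚ.∣ b ℚ.- d ∣ ℚ.≤ ½* ε ÷⁺ 0<K →
              a ℚ.* b ℚ.≤ c ℚ.* d ℚ.+ ε
*-lipschitz a b c d {ε} {K} {L} 0<K 0<L b≤L c≤K ac bd =
  ∸⇒≤ {a ℚ.* b} {c ℚ.* d} {ε} (subst₂ ℚ._≤_ (*-split a b c d) (½+½ ε)
    (ℚP.+-mono-≤ {(a ℚ.- c) ℚ.* b} {½* ε} {(b ℚ.- d) ℚ.* c} {½* ε} e₁ e₂))
  where
  e₁ : (a ℚ.- c) ℚ.* b ℚ.≤ ½* ε
  e₁ = subst ((a ℚ.- c) ℚ.* b ℚ.≤_) (÷⁺-* (½* ε) 0<L)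
         (*≤*∣∣ {a ℚ.- c} {b} {½* ε ÷⁺ 0<L} {L} ac b≤L)
  e₂ : (b ℚ.- d) ℚ.* c ℚ.≤ ½* ε
  e₂ = subst ((b ℚ.- d) ℚ.* c ℚ.≤_) (÷⁺-* (½* ε) 0<K)
         (*≤*∣∣ {b ℚ.- d} {c} {½* ε ÷⁺ 0<K} {K} bd c≤K)

_*_ : ℝ → ℝ → ℝ
seq (x * y) m = seq x m ℚ.* seq y m
cauchy (x * y) ε 0<ε = A ℕ.⊔ B ℕ.⊔ (M ℕ.⊔ N) , λ m n p q →
  *-lipschitz (seq x m) (seq y m) (seq x n) (seq y n) {ε} {K} {L} 0<K 0<L
    (by m (B≤ p)) (bx n (A≤ q))
    (∣∣≤ {seq x m} {seq x n} {η} (hx m n (M≤ p) (M≤ q)) (hx n m (M≤ q) (M≤ p)))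
    (∣∣≤ {seq y m} {seq y n} {θ} (hy m n (N≤ p) (N≤ q)) (hy n m (N≤ q) (N≤ p)))
  where
  K = proj₁ (bounded x)
  0<K = proj₁ (proj₂ (bounded x))
  A = proj₁ (proj₂ (proj₂ (bounded x)))
  bx = proj₂ (proj₂ (proj₂ (bounded x)))
  L = proj₁ (bounded y)
  0<L = proj₁ (proj₂ (bounded y))
  B = proj₁ (proj₂ (proj₂ (bounded y)))
  by = proj₂ (proj₂ (proj₂ (bounded y)))
  η = ½* ε ÷⁺ 0<L
  θ = ½* ε ÷⁺ 0<K
  cx = cauchy x η (÷⁺-pos {½* ε} (½*-pos {ε} 0<ε) 0<L)
  cy = cauchy y θ (÷⁺-pos {½* ε} (½*-pos {ε} 0<ε) 0<K)
  M = proj₁ cx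
  hx = proj₂ cx
  N = proj₁ cy
  hy = proj₂ cy
  AB : ∀ {k} → A ℕ.⊔ B ℕ.⊔ (M ℕ.⊔ N) ℕ.≤ k → A ℕ.⊔ B ℕ.≤ k
  AB = ℕP.m⊔n≤o⇒m≤o (A ℕ.⊔ B) (M ℕ.⊔ N)
  MN : ∀ {k} → A ℕ.⊔ B ℕ.⊔ (M ℕ.⊔ N) ℕ.≤ k → M ℕ.⊔ N ℕ.≤ k
  MN = ℕP.m⊔n≤o⇒n≤o (A ℕ.⊔ B) (M ℕ.⊔ N)
  A≤ : ∀ {k} → A ℕ.⊔ B ℕ.⊔ (M ℕ.⊔ N) ℕ.≤ k → A ℕ.≤ k
  A≤ r = ℕP.m⊔n≤o⇒m≤o A B (AB r)
  B≤ : ∀ {k} → A ℕ.⊔ B ℕ.⊔ (M ℕ.⊔ N) ℕ.≤ k → B ℕ.≤ k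
  B≤ r = ℕP.m⊔n≤o⇒n≤o A B (AB r)
  M≤ : ∀ {k} → A ℕ.⊔ B ℕ.⊔ (M ℕ.⊔ N) ℕ.≤ k → M ℕ.≤ k
  M≤ r = ℕP.m⊔n≤o⇒m≤o M N (MN r)
  N≤ : ∀ {k} → A ℕ.⊔ B ℕ.⊔ (M ℕ.⊔ N) ℕ.≤ k → N ℕ.≤ k
  N≤ r = ℕP.m⊔n≤o⇒n≤o M N (MN r)

⊔-pos : ∀ q {δ} → 0ℚ ℚ.< δ → 0ℚ ℚ.< q ℚ.⊔ δ
⊔-pos q {δ} 0<δ = ℚP.<-≤-trans 0<δ (ℚP.p≤q⊔p q δ)

1/⁺ : ∀ {q} → 0ℚ ℚ.< q → ℚ
1/⁺ {q} 0<q = (ℚ.1/ q) {{ℚ.>-nonZero 0<q}}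

1/⁺-bound : ∀ {a b δ ε} (0<a : 0ℚ ℚ.< a) (0<b : 0ℚ ℚ.< b) → 0ℚ ℚ.< δ →
            δ ℚ.≤ a → δ ℚ.≤ b → 0ℚ ℚ.< ε →
            b ℚ.≤ a ℚ.+ ε ℚ.* (δ ℚ.* δ) → 1/⁺ 0<a ℚ.≤ 1/⁺ 0<b ℚ.+ ε
1/⁺-bound {a} {b} {δ} {ε} 0<a 0<b 0<δ δ≤a δ≤b 0<ε h =
  ℚP.*-cancelʳ-≤-pos (a ℚ.* b) {{ab>0}} (subst₂ ℚ._≤_ (sym lhs) (sym rhs) h′)
  where
  instance
    _ = ℚ.>-nonZero 0<a
    _ = ℚ.>-nonZero 0<b
  ab>0 : ℚ.Positive (a ℚ.* b)
  ab>0 = ℚP.pos*pos⇒pos a {{ℚ.positive 0<a}} b {{ℚ.positive 0<b}}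
  δδ≤ab : δ ℚ.* δ ℚ.≤ a ℚ.* b
  δδ≤ab = ℚP.≤-trans
    (ℚP.*-monoʳ-≤-nonNeg δ {{ℚ.nonNegative (ℚP.<⇒≤ 0<δ)}} δ≤a)
    (ℚP.*-monoˡ-≤-nonNeg a {{ℚ.nonNegative (ℚP.<⇒≤ 0<a)}} δ≤b)
  h′ : b ℚ.≤ a ℚ.+ ε ℚ.* (a ℚ.* b)
  h′ = ℚP.≤-trans h (ℚP.+-monoʳ-≤ a
         (ℚP.*-monoˡ-≤-nonNeg ε {{ℚ.nonNegative (ℚP.<⇒≤ 0<ε)}} δδ≤ab))
  lhs : ℚ.1/ a ℚ.* (a ℚ.* b) ≡ b
  lhs = trans (sym (ℚP.*-assoc (ℚ.1/ a) a b))
          (trans (cong (ℚ._* b) (ℚP.*-inverseˡ a)) (ℚP.*-identityˡ b))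
  rhs : (ℚ.1/ b ℚ.+ ε) ℚ.* (a ℚ.* b) ≡ a ℚ.+ ε ℚ.* (a ℚ.* b)
  rhs = trans
    (recip-split (ℚ.1/ b) a b ε)
    (cong (ℚ._+ ε ℚ.* (a ℚ.* b))
      (trans (cong (ℚ._* a) (ℚP.*-inverseˡ b)) (ℚP.*-identityˡ a)))

-- The witness makes seq x m ≥ δ > 0 for large m, so ⊔ δ changes only finitely
-- many terms and keeps all of them nonzero.
recip : ∀ x → 0ℝ < x → ℝ
seq (recip x (δ , 0<δ , _)) m = 1/⁺ (⊔-pos (seq x m) 0<δ)
cauchy (recip x (δ , 0<δ , _)) ε 0<ε
  with cauchy x (ε ℚ.* (δ ℚ.* δ))
         (ℚP.positive⁻¹ _ {{ℚP.pos*pos⇒pos ε {{ℚ.positive 0<ε}} _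
           {{ℚP.pos*pos⇒pos δ {{ℚ.positive 0<δ}} δ {{ℚ.positive 0<δ}}}}}})
... | N , h = N , λ m n p q →
  let a = seq x m
      b = seq x n
      η = ε ℚ.* (δ ℚ.* δ)
      η≥0 : 0ℚ ℚ.≤ η
      η≥0 = ℚP.nonNegative⁻¹ _ {{ℚP.nonNeg*nonNeg⇒nonNeg ε {{ℚ.nonNegative (ℚP.<⇒≤ 0<ε)}} _
        {{ℚP.nonNeg*nonNeg⇒nonNeg δ {{ℚ.nonNegative (ℚP.<⇒≤ 0<δ)}}
            δ {{ℚ.nonNegative (ℚP.<⇒≤ 0<δ)}}}}}}
  in 1/⁺-bound (⊔-pos a 0<δ) (⊔-pos b 0<δ) 0<δ
       (ℚP.p≤q⊔p a δ) (ℚP.p≤q⊔p b δ) 0<ε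
       (ℚP.⊔-lub
         (ℚP.≤-trans (h n m q p) (ℚP.+-monoˡ-≤ η (ℚP.p≤p⊔q a δ)))
         (ℚP.≤-trans (ℚP.p≤q⊔p a δ)
           (subst (ℚ._≤ (a ℚ.⊔ δ) ℚ.+ η) (ℚP.+-identityʳ (a ℚ.⊔ δ))
             (ℚP.+-monoʳ-≤ (a ℚ.⊔ δ) η≥0))))

_/_[_] : ℝ → (y : ℝ) → 0ℝ < y → ℝ
x / y [ 0<y ] = x * recip y 0<y

1/suc : ℕ → ℚ
1/suc k = + 1 ℚ./ suc k

/≃ : ∀ a k → ℚ.toℚᵘ (+ a ℚ./ suc k) ℚᵘ.≃ ℚᵘ.mkℚᵘ (+ a) k
/≃ a k = ℚP.toℚᵘ-fromℚᵘ (ℚᵘ.mkℚᵘ (+ a) k)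

/-mono-≤ : ∀ a b j k → a ℕ.* suc k ℕ.≤ b ℕ.* suc j → + a ℚ./ suc j ℚ.≤ + b ℚ./ suc k
/-mono-≤ a b j k h = ℚP.toℚᵘ-cancel-≤
  (ℚᵘP.≤-respʳ-≃ (ℚᵘP.≃-sym (/≃ b k)) (ℚᵘP.≤-respˡ-≃ (ℚᵘP.≃-sym (/≃ a j))
    (ℚᵘ.*≤* (subst₂ ℤ._≤_ (ℤP.pos-* a (suc k)) (ℤP.pos-* b (suc j)) (ℤ.+≤+ h)))))

suc/ : ∀ a k → + suc a ℚ./ suc k ≡ + a ℚ./ suc k ℚ.+ 1/suc k
suc/ a k = ℚP.toℚᵘ-injective (begin
  ℚ.toℚᵘ (+ suc a ℚ./ suc k)                         ≈⟨ /≃ (suc a) k ⟩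
  ℚᵘ.mkℚᵘ (+ suc a) k                                ≈⟨ ℚᵘ.*≡* eq ⟩
  ℚᵘ.mkℚᵘ (+ a) k ℚᵘ.+ ℚᵘ.mkℚᵘ (+ 1) k
    ≈⟨ ℚᵘP.+-cong (ℚᵘP.≃-sym (/≃ a k)) (ℚᵘP.≃-sym (/≃ 1 k)) ⟩
  ℚ.toℚᵘ (+ a ℚ./ suc k) ℚᵘ.+ ℚ.toℚᵘ (1/suc k)
    ≈⟨ ℚᵘP.≃-sym (ℚP.toℚᵘ-homo-+ (+ a ℚ./ suc k) (1/suc k)) ⟩
  ℚ.toℚᵘ (+ a ℚ./ suc k ℚ.+ 1/suc k)                 ∎)
  where
  open import Relation.Binary.Reasoning.Setoid ℚᵘP.≃-setoid
  K = + suc k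
  eq : + suc a ℤ.* (K ℤ.* K) ≡ (+ a ℤ.* K ℤ.+ + 1 ℤ.* K) ℤ.* K
  eq = trans (sym (ℤP.*-assoc (+ suc a) K K))
    (cong (ℤ._* K) (trans (cong (ℤ._* K) (ℤP.+-comm (+ 1) (+ a)))
                          (ℤP.*-distribʳ-+ K (+ a) (+ 1))))

1/suc≤ : ∀ {ε} → 0ℚ ℚ.< ε → ∀ k → ℚ.↧ₙ ε ℕ.≤ k → 1/suc k ℚ.≤ ε
1/suc≤ {ε@(mkℚ (+ zero) d-1 _)} 0<ε =
  contradiction (ℚP.drop-*<* 0<ε) λ { (ℤ.+<+ ()) }
1/suc≤ {ε@(mkℚ (ℤ.-[1+ _ ]) d-1 _)} 0<ε =
  contradiction (ℚP.drop-*<* 0<ε) λ ()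
1/suc≤ {ε@(mkℚ (+ suc a) d-1 _)} 0<ε k d≤k =
  subst (1/suc k ℚ.≤_) (ℚP.↥p/↧p≡p ε) (/-mono-≤ 1 (suc a) k d-1
    (subst (ℕ._≤ suc a ℕ.* suc k) (sym (ℕP.*-identityˡ (suc d-1)))
      (ℕP.≤-trans (ℕP.m≤n⇒m≤1+n d≤k) (ℕP.m≤m+n (suc k) (a ℕ.* suc k)))))

2^⌊log₂⌋≤ : ∀ n → .{{ℕ.NonZero n}} → 2 ℕ.^ ⌊log₂ n ⌋ ℕ.≤ n
2^⌊log₂⌋≤ = <-rec (λ n → .{{ℕ.NonZero n}} → 2 ℕ.^ ⌊log₂ n ⌋ ℕ.≤ n) step
  where
  step : ∀ n → (∀ {m} → m ℕ.< n → .{{ℕ.NonZero m}} → 2 ℕ.^ ⌊log₂ m ⌋ ℕ.≤ m) →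
         .{{ℕ.NonZero n}} → 2 ℕ.^ ⌊log₂ n ⌋ ℕ.≤ n
  step (suc zero) _ = ℕP.≤-refl
  step n@(suc (suc k)) rec = ℕP.≤-trans
    (ℕP.^-monoʳ-≤ 2 (ℕP.≤-trans (ℕP.m≤n+m∸n ⌊log₂ n ⌋ 1)
      (ℕP.≤-reflexive (cong suc (sym (⌊log₂⌊n/2⌋⌋≡⌊log₂n⌋∸1 n))))))
    (ℕP.≤-trans (ℕP.*-monoʳ-≤ 2 (rec {ℕ.⌊ n /2⌋} (ℕP.⌊n/2⌋<n (suc k))))
      (ℕP.≤-trans (ℕP.+-monoʳ-≤ ℕ.⌊ n /2⌋
        (ℕP.≤-trans (ℕP.≤-reflexive (ℕP.+-identityʳ ℕ.⌊ n /2⌋)) (ℕP.⌊n/2⌋≤⌈n/2⌉ n)))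
        (ℕP.≤-reflexive (ℕP.⌊n/2⌋+⌈n/2⌉≡n n))))

<2^suc⌊log₂⌋ : ∀ n → n ℕ.< 2 ℕ.^ suc ⌊log₂ n ⌋
<2^suc⌊log₂⌋ n = ℕP.≰⇒> λ h → ℕP.<-irrefl refl
  (subst (ℕ._≤ ⌊log₂ n ⌋) (⌊log₂[2^n]⌋≡n (suc ⌊log₂ n ⌋)) (⌊log₂⌋-mono-≤ h))

⌊log₂^⌋ : ∀ n j k → ⌊log₂ n ℕ.^ suc j ⌋ ℕ.* suc k ℕ.≤ suc ⌊log₂ n ℕ.^ suc k ⌋ ℕ.* suc j
⌊log₂^⌋ zero j k = z≤n
⌊log₂^⌋ n@(suc _) j k = ℕP.≮⇒≥ λ h → ℕP.<-irrefl refl (begin-strict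
  2 ℕ.^ (suc q ℕ.* suc j)      ≤⟨ ℕP.^-monoʳ-≤ 2 (ℕP.<⇒≤ h) ⟩
  2 ℕ.^ (p ℕ.* suc k)          ≡⟨ sym (ℕP.^-*-assoc 2 p (suc k)) ⟩
  (2 ℕ.^ p) ℕ.^ suc k          ≤⟨ ℕP.^-monoˡ-≤ (suc k)
                                   (2^⌊log₂⌋≤ (n ℕ.^ suc j) {{ℕP.m^n≢0 n (suc j)}}) ⟩
  (n ℕ.^ suc j) ℕ.^ suc k      ≡⟨ ℕP.^-*-assoc n (suc j) (suc k) ⟩
  n ℕ.^ (suc j ℕ.* suc k)      ≡⟨ cong (n ℕ.^_) (ℕP.*-comm (suc j) (suc k)) ⟩
  n ℕ.^ (suc k ℕ.* suc j)      ≡⟨ sym (ℕP.^-*-assoc n (suc k) (suc j)) ⟩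
  (n ℕ.^ suc k) ℕ.^ suc j      <⟨ ℕP.^-monoˡ-< (suc j) (<2^suc⌊log₂⌋ (n ℕ.^ suc k)) ⟩
  (2 ℕ.^ suc q) ℕ.^ suc j      ≡⟨ ℕP.^-*-assoc 2 (suc q) (suc j) ⟩
  2 ℕ.^ (suc q ℕ.* suc j)      ∎)
  where
  open ℕP.≤-Reasoning
  p = ⌊log₂ n ℕ.^ suc j ⌋
  q = ⌊log₂ n ℕ.^ suc k ⌋

-- From 2 ^ p ≤ n ^ k < 2 ^ (1 + p), where p = ⌊log₂ n ^ k ⌋, the base-two
-- logarithm of n lies in the interval [p / k , (1 + p) / k).
log₂ : ℕ → ℝ
seq (log₂ n) k = + ⌊log₂ n ℕ.^ suc k ⌋ ℚ./ suc k
cauchy (log₂ n) ε 0<ε = ℚ.↧ₙ ε , λ j k _ d≤k →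
  let p = ⌊log₂ n ℕ.^ suc j ⌋
      q = ⌊log₂ n ℕ.^ suc k ⌋
  in ℚP.≤-trans (/-mono-≤ p (suc q) j k (⌊log₂^⌋ n j k))
       (ℚP.≤-trans (ℚP.≤-reflexive (suc/ q k))
         (ℚP.+-monoʳ-≤ (+ q ℚ./ suc k) (1/suc≤ 0<ε k d≤k)))

log₂-pos : ∀ {n} → 2 ℕ.≤ n → 0ℝ < log₂ n
log₂-pos {n} 2≤n = 1ℚ , ℚP.positive⁻¹ 1ℚ , 0 , λ k _ →
  ℚP.≤-trans (ℚP.≤-reflexive (ℚP.+-identityˡ 1ℚ))
    (/-mono-≤ 1 ⌊log₂ n ℕ.^ suc k ⌋ 0 k
      (subst₂ ℕ._≤_ (sym (ℕP.*-identityˡ (suc k)))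
                    (sym (ℕP.*-identityʳ ⌊log₂ n ℕ.^ suc k ⌋))
        (subst (ℕ._≤ ⌊log₂ n ℕ.^ suc k ⌋) (⌊log₂[2^n]⌋≡n (suc k))
          (⌊log₂⌋-mono-≤ (ℕP.^-monoˡ-≤ (suc k) 2≤n)))))

⌊√_⌋ : ℕ → ℕ
⌊√ zero ⌋ = 0
⌊√ suc n ⌋ with suc ⌊√ n ⌋ ℕ.* suc ⌊√ n ⌋ ℕP.≤? suc n
... | yes _ = suc ⌊√ n ⌋
... | no  _ = ⌊√ n ⌋

-- For q ≥ 0 this is the largest multiple of 1 / (1 + k) with square at most q.
√ℚ : ℚ → ℕ → ℚ
√ℚ q k = + ⌊√ (ℤ.∣ ℚ.↥ q ∣ ℕ.* (suc k ℕ.* suc k)) ℕ./ (ℚ.↧ₙ q) ⌋ ℚ./ suc k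

⌊√⌋-lower : ∀ n → ⌊√ n ⌋ ℕ.* ⌊√ n ⌋ ℕ.≤ n
⌊√⌋-lower zero = z≤n
⌊√⌋-lower (suc n) with suc ⌊√ n ⌋ ℕ.* suc ⌊√ n ⌋ ℕP.≤? suc n
... | yes h = h
... | no  _ = ℕP.m≤n⇒m≤1+n (⌊√⌋-lower n)

⌊√⌋-upper : ∀ n → n ℕ.< suc ⌊√ n ⌋ ℕ.* suc ⌊√ n ⌋
⌊√⌋-upper zero = s≤s z≤n
⌊√⌋-upper (suc n) with suc ⌊√ n ⌋ ℕ.* suc ⌊√ n ⌋ ℕP.≤? suc n
... | yes _ = ℕP.≤-<-trans (⌊√⌋-upper n)
                (ℕP.*-mono-< (ℕP.n<1+n (suc ⌊√ n ⌋)) (ℕP.n<1+n (suc ⌊√ n ⌋)))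
... | no  h = ℕP.≰⇒> h

/-sq : ∀ r k → ℚ.toℚᵘ ((+ r ℚ./ suc k) ℚ.* (+ r ℚ./ suc k)) ℚᵘ.≃
               ℚᵘ.mkℚᵘ (+ r) k ℚᵘ.* ℚᵘ.mkℚᵘ (+ r) k
/-sq r k = ℚᵘP.≃-trans (ℚP.toℚᵘ-homo-* (+ r ℚ./ suc k) (+ r ℚ./ suc k))
                       (ℚᵘP.*-cong (/≃ r k) (/≃ r k))

pos-*₃ : ∀ a b c → + (a ℕ.* b ℕ.* c) ≡ + a ℤ.* + b ℤ.* + c
pos-*₃ a b c = trans (ℤP.pos-* (a ℕ.* b) c) (cong (ℤ._* + c) (ℤP.pos-* a b))

√ℚ-lower : ∀ q k → 0ℚ ℚ.≤ q → √ℚ q k ℚ.* √ℚ q k ℚ.≤ q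
√ℚ-lower (mkℚ (ℤ.-[1+ _ ]) _ _) k 0≤q = contradiction (ℚP.drop-*≤* 0≤q) λ ()
√ℚ-lower q@(mkℚ (+ a) d-1 _) k _ = ℚP.toℚᵘ-cancel-≤
  (ℚᵘP.≤-respˡ-≃ (ℚᵘP.≃-sym (/-sq r k))
    (ℚᵘ.*≤* (subst₂ ℤ._≤_ (pos-*₃ r r D) (ℤP.pos-* a (K ℕ.* K)) (ℤ.+≤+
      (ℕP.≤-trans (ℕP.*-monoˡ-≤ D (⌊√⌋-lower ((a ℕ.* (K ℕ.* K)) ℕ./ D)))
                  (ℕDM.m/n*n≤m (a ℕ.* (K ℕ.* K)) D))))))
  where
  K = suc k
  D = suc d-1
  r = ⌊√ (a ℕ.* (K ℕ.* K)) ℕ./ D ⌋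

√ℚ-upper : ∀ q k → 0ℚ ℚ.≤ q →
           q ℚ.< (√ℚ q k ℚ.+ 1/suc k) ℚ.* (√ℚ q k ℚ.+ 1/suc k)
√ℚ-upper (mkℚ (ℤ.-[1+ _ ]) _ _) k 0≤q = contradiction (ℚP.drop-*≤* 0≤q) λ ()
√ℚ-upper q@(mkℚ (+ a) d-1 _) k _ =
  subst (λ t → q ℚ.< t ℚ.* t) (suc/ r k) (ℚP.toℚᵘ-cancel-<
    (ℚᵘP.<-respʳ-≃ (ℚᵘP.≃-sym (/-sq (suc r) k))
      (ℚᵘ.*<* (subst₂ ℤ._<_ (ℤP.pos-* a (K ℕ.* K)) (pos-*₃ (suc r) (suc r) D)
        (ℤ.+<+ bound)))))
  where
  K = suc k
  D = suc d-1
  e = a ℕ.* (K ℕ.* K)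
  r = ⌊√ e ℕ./ D ⌋
  bound : e ℕ.< suc r ℕ.* suc r ℕ.* D
  bound = ℕP.<-≤-trans
    (subst (ℕ._< D ℕ.+ e ℕ./ D ℕ.* D) (sym (ℕDM.m≡m%n+[m/n]*n e D))
      (ℕP.+-monoˡ-< (e ℕ./ D ℕ.* D) (ℕDM.m%n<n e D)))
    (ℕP.*-monoˡ-≤ D (⌊√⌋-upper (e ℕ./ D)))

sq-mono-≤ : ∀ {a b} → 0ℚ ℚ.≤ a → a ℚ.≤ b → a ℚ.* a ℚ.≤ b ℚ.* b
sq-mono-≤ {a} {b} 0≤a a≤b = ℚP.≤-trans
  (ℚP.*-monoˡ-≤-nonNeg a {{ℚ.nonNegative 0≤a}} a≤b)
  (ℚP.*-monoʳ-≤-nonNeg b {{ℚ.nonNegative (ℚP.≤-trans 0≤a a≤b)}} a≤b)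

sq-+ : ∀ t e → (t ℚ.+ e) ℚ.* (t ℚ.+ e) ≡ (t ℚ.* t ℚ.+ e ℚ.* e) ℚ.+ (t ℚ.* e ℚ.+ t ℚ.* e)
sq-+ = solve 2 (λ t e → (t :+ e) :* (t :+ e) := (t :* t :+ e :* e) :+ (t :* e :+ t :* e)) refl

√ℚ≥0 : ∀ q k → 0ℚ ℚ.≤ √ℚ q k
√ℚ≥0 q k = ℚP.nonNegative⁻¹ (√ℚ q k)
  {{ℚP.normalize-nonNeg
      ⌊√ (ℤ.∣ ℚ.↥ q ∣ ℕ.* (suc k ℕ.* suc k)) ℕ./ (ℚ.↧ₙ q) ⌋ (suc k)}}

≤+nonNeg : ∀ a {b} → 0ℚ ℚ.≤ b → a ℚ.≤ a ℚ.+ b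
≤+nonNeg a {b} 0≤b = subst (ℚ._≤ a ℚ.+ b) (ℚP.+-identityʳ a) (ℚP.+-monoʳ-≤ a 0≤b)

√ℚ-close : ∀ p q ε j k → 0ℚ ℚ.≤ p → 0ℚ ℚ.≤ q → 0ℚ ℚ.< ε → 1/suc k ℚ.≤ ½* ε →
           p ℚ.≤ q ℚ.+ ½* ε ℚ.* ½* ε → √ℚ p j ℚ.≤ √ℚ q k ℚ.+ ε
√ℚ-close p q ε j k 0≤p 0≤q 0<ε 1/k≤ h = ℚP.≮⇒≥ λ lt → ℚP.<-irrefl refl (begin-strict
  p                          ≤⟨ h ⟩
  q ℚ.+ η ℚ.* η              <⟨ ℚP.+-monoˡ-< (η ℚ.* η) (√ℚ-upper q k 0≤q) ⟩
  t ℚ.* t ℚ.+ η ℚ.* η        ≤⟨ ≤+nonNeg (t ℚ.* t ℚ.+ η ℚ.* η) 0≤2tη ⟩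
  (t ℚ.* t ℚ.+ η ℚ.* η) ℚ.+ (t ℚ.* η ℚ.+ t ℚ.* η)  ≡⟨ sym (sq-+ t η) ⟩
  (t ℚ.+ η) ℚ.* (t ℚ.+ η)    ≤⟨ sq-mono-≤ 0≤t+η (ℚP.≤-trans t+η≤ (ℚP.<⇒≤ lt)) ⟩
  √ℚ p j ℚ.* √ℚ p j          ≤⟨ √ℚ-lower p j 0≤p ⟩
  p                          ∎)
  where
  open ℚP.≤-Reasoning
  η = ½* ε
  t = √ℚ q k ℚ.+ 1/suc k
  0≤η : 0ℚ ℚ.≤ η
  0≤η = ℚP.<⇒≤ (½*-pos 0<ε)
  0≤t : 0ℚ ℚ.≤ t
  0≤t = ℚP.+-mono-≤ (√ℚ≥0 q k)
          (ℚP.nonNegative⁻¹ (1/suc k) {{ℚP.normalize-nonNeg 1 (suc k)}})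
  0≤t+η : 0ℚ ℚ.≤ t ℚ.+ η
  0≤t+η = ℚP.+-mono-≤ 0≤t 0≤η
  0≤tη : 0ℚ ℚ.≤ t ℚ.* η
  0≤tη = ℚP.nonNegative⁻¹ _
    {{ℚP.nonNeg*nonNeg⇒nonNeg t {{ℚ.nonNegative 0≤t}} η {{ℚ.nonNegative 0≤η}}}}
  0≤2tη : 0ℚ ℚ.≤ t ℚ.* η ℚ.+ t ℚ.* η
  0≤2tη = ℚP.+-mono-≤ 0≤tη 0≤tη
  t+η≤ : t ℚ.+ η ℚ.≤ √ℚ q k ℚ.+ ε
  t+η≤ = subst₂ ℚ._≤_ (sym (ℚP.+-assoc (√ℚ q k) (1/suc k) η))
           (cong (√ℚ q k ℚ.+_) (½+½ ε))
           (ℚP.+-monoʳ-≤ (√ℚ q k) (ℚP.+-monoˡ-≤ η 1/k≤))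

-- Negative arguments are truncated to zero.
√_ : ℝ → ℝ
seq (√ x) k = √ℚ (seq x k ℚ.⊔ 0ℚ) k
cauchy (√ x) ε 0<ε = N ℕ.⊔ D , λ j k p q →
  √ℚ-close (seq x j ℚ.⊔ 0ℚ) (seq x k ℚ.⊔ 0ℚ) ε j k
    (ℚP.p≤q⊔p (seq x j) 0ℚ) (ℚP.p≤q⊔p (seq x k) 0ℚ) 0<ε
    (1/suc≤ (½*-pos 0<ε) k (ℕP.m⊔n≤o⇒n≤o N D q))
    (ℚP.⊔-lub
      (ℚP.≤-trans (hx j k (ℕP.m⊔n≤o⇒m≤o N D p) (ℕP.m⊔n≤o⇒m≤o N D q))
                  (ℚP.+-monoˡ-≤ η² (ℚP.p≤p⊔q (seq x k) 0ℚ)))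
      (ℚP.+-mono-≤ (ℚP.p≤q⊔p (seq x k) 0ℚ) (ℚP.<⇒≤ 0<η²)))
  where
  D = ℚ.↧ₙ (½* ε)
  η² = ½* ε ℚ.* ½* ε
  0<η² : 0ℚ ℚ.< η²
  0<η² = ℚP.positive⁻¹ η²
    {{ℚP.pos*pos⇒pos (½* ε) {{ℚ.positive (½*-pos 0<ε)}} (½* ε) {{ℚ.positive (½*-pos 0<ε)}}}}
  N = proj₁ (cauchy x η² 0<η²)
  hx = proj₂ (cauchy x η² 0<η²)

-- The circle ℝ/ℤ: reals, compared up to an integer.
𝕋 : Set
𝕋 = ℝ

infix 4 _≈𝕋_

_≈𝕋_ : 𝕋 → 𝕋 → Set
x ≈𝕋 y = ∃[ k ] (x ≃ y + fromℤ k)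

-- r = ι(z)
IsRepresentative : 𝕋 → ℝ → Set
IsRepresentative z r = fromℚ ℚ.-½ ≤ r × r < fromℚ ℚ.½ × r ≈𝕋 z

Cube : ℕ → Set
Cube n = Vec Bool n

bit : Bool → ℕ
bit false = 0
bit true  = 1

weight : ∀ {n} → Cube n → ℕ
weight x = Vec.sum (Vec.map bit x)

maxCube : ∀ {n} → (Cube n → ℝ) → ℝ
maxCube {zero}  F = F []
maxCube {suc n} F = maxCube (λ x → F (false ∷ x)) ⊔ maxCube (λ x → F (true ∷ x))

-- ι is not a computable function of the real representing z, so it enters as a
-- family of representatives; it is determined up to _≃_.
‖_mod1‖∞≤_ : ∀ {n} → (Cube n → 𝕋) → ℝ → Set
‖_mod1‖∞≤_ {n} F ε =
  Σ[ ι ∈ (Cube n → ℝ) ] ((∀ x → IsRepresentative (F x) (ι x)) × maxCube (λ x → ∣ ι x ∣) ≤ ε)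

subsets : ∀ n → List (Subset n)
subsets zero    = [] ∷ []
subsets (suc n) = List.map (outside ∷_) (subsets n) ++ List.map (inside ∷_) (subsets n)

monomial : ∀ {n} → Subset n → Cube n → ℕ
monomial []            []      = 1
monomial (outside ∷ S) (b ∷ x) = monomial S x
monomial (inside  ∷ S) (b ∷ x) = bit b ℕ.* monomial S x

∑ : ∀ {A : Set} → List A → (A → ℝ) → ℝ
∑ xs f = List.foldr (λ a s → f a + s) 0ℝ xs

polynomial : ∀ {n} → ℕ → (Subset n → ℝ) → Cube n → ℝ
polynomial {n} d P x =
  ∑ (List.filter (λ S → card S ℕP.≤? d) (subsets n)) (λ S → P S * fromℕ (monomial S x))

IsSymmetricTorusPolynomial : ∀ {n} → ℕ → (Cube n → 𝕋) → Set
IsSymmetricTorusPolynomial {n} d Q = Σ[ P ∈ (Subset n → ℝ) ]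
  ((∀ S T → card S ≡ card T → P S ≃ P T) × (∀ x → Q x ≈𝕋 polynomial d P x))

_Approximates[_]_ : ∀ {n} → (Cube n → 𝕋) → ℝ → (Cube n → Bool) → Set
P Approximates[ ε ] f = ‖ (λ x → P x - fromℚ (+ bit (f x) ℚ./ 2)) mod1‖∞≤ ε

Δ : ∀ {n} → ℕ → Cube n → Bool
Δ w x = does (weight x ℕP.≟ w)

1/20n : ∀ n → 2 ℕ.≤ n → ℝ
1/20n n 2≤n = fromℚ ((+ 1 ℚ./ (20 ℕ.* n))
  {{ℕP.m*n≢0 20 n {{_}} {{ℕ.>-nonZero (ℕP.<⇒≤ 2≤n)}}}})

{-# OPTIONS --safe #-}

-- The polynomials Q_w sum up to approximations of all 2^(n+1) symmetric functions,
-- while rounding the d + 1 coefficients to multiples of 1 / M, with M of order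
-- n^(d+1), leaves only M^(d+1) polynomials modulo one.  If there were fewer of
-- these than symmetric functions, two sums of rounded Q_w over different sets of
-- weights would agree.  Their difference, at a point whose weight v lies in just one
-- of the sets, is 1/2 up to the errors of the Q_w, yet also an integer.  Hence
-- 2^(n+1) ≤ M^(d+1) = 2^O(d² log n).
module Submission where

open import Defs
open import Data.Bool.Base using (Bool; true; false)
open import Data.Fin.Base as Fin using (Fin; zero; suc; toℕ; fromℕ<; finToFun; funToFin; punchIn)
import Data.Fin.Properties as FinP
open import Data.Fin.Subset using (Subset; inside; outside) renaming (∣_∣ to card)
import Data.Fin.Subset.Properties as SubsetP
open import Data.Integer.Base as ℤ using (ℤ; +_; 0ℤ; 1ℤ)
import Data.Integer.DivMod as ℤDM
open import Data.Integer.Divisibility.Signed as ℤD using (_∣_; divides)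
import Data.Integer.Properties as ℤP
import Data.Integer.Solver as ℤS
open import Data.List.Base as List using (List; []; _∷_)
import Data.List.Properties as ListP
open import Data.List.Relation.Unary.All using (All; []; _∷_)
import Data.List.Relation.Unary.All.Properties as AllP
open import Data.Nat.Base as ℕ using (ℕ; zero; suc; z≤n; s≤s)
import Data.Nat.Divisibility as ℕD
open import Data.Nat.Logarithm using (⌊log₂_⌋; ⌊log₂⌋-mono-≤; ⌊log₂[2^n]⌋≡n)
import Data.Nat.Properties as ℕP
import Data.Nat.Solver as ℕS
open import Data.Product.Base using (∃-syntax; Σ-syntax; _×_; _,_; proj₁; proj₂; map₂)
open import Data.Rational.Base as ℚ using (ℚ; 0ℚ; 1ℚ)
import Data.Rational.Properties as ℚP
import Data.Rational.Solver as ℚS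
import Data.Rational.Unnormalised.Base as ℚᵘ
import Data.Rational.Unnormalised.Properties as ℚᵘP
open import Data.Sum.Base using (inj₁; inj₂)
open import Data.Vec.Base using ([]; _∷_)
open import Data.Vec.Functional using (Vector; removeAt)
open import Algebra.Properties.Semiring.Sum ℤP.+-*-semiring
  using (sum; sum-cong-≗; sum-replicate-zero; sum-remove; ∑-distrib-+; *-distribˡ-sum; *-distribʳ-sum)
open import Function.Base using (_∘_)
open import Relation.Binary.PropositionalEquality
  using (_≡_; _≢_; _≗_; refl; sym; trans; cong; cong₂; subst; module ≡-Reasoning)
open import Relation.Nullary using (yes; no; ¬_; contradiction)
open import Relation.Nullary.Decidable using (dec-true; dec-false; does)
open import Relation.Unary using (Decidable)

-- Low-degree multilinear polynomials with integer coefficients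

length-filter-map : ∀ {A B : Set} {P : B → Set} {Q : A → Set} (P? : Decidable P) (Q? : Decidable Q)
  (f : A → B) → (∀ {a} → P (f a) → Q a) → (∀ {a} → Q a → P (f a)) → ∀ xs →
  List.length (List.filter P? (List.map f xs)) ≡ List.length (List.filter Q? xs)
length-filter-map P? Q? f P⇒Q Q⇒P []       = refl
length-filter-map P? Q? f P⇒Q Q⇒P (a ∷ xs) with P? (f a) | Q? a
... | yes _ | yes _ = cong suc (length-filter-map P? Q? f P⇒Q Q⇒P xs)
... | no  _ | no  _ = length-filter-map P? Q? f P⇒Q Q⇒P xs
... | yes p | no ¬q = contradiction (P⇒Q p) ¬q
... | no ¬p | yes q = contradiction (Q⇒P q) ¬p

card≤? : ∀ {n} d → Decidable (λ (S : Subset n) → card S ℕ.≤ d)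
card≤? d S = card S ℕP.≤? d

filter-≤-outside : ∀ {n} d (xs : List (Subset n)) →
  List.length (List.filter (card≤? d) (List.map (outside ∷_) xs)) ≡
  List.length (List.filter (card≤? d) xs)
filter-≤-outside d = length-filter-map (card≤? d) (card≤? d) (outside ∷_) (λ p → p) (λ p → p)

filter-≤-inside : ∀ {n} d (xs : List (Subset n)) →
  List.length (List.filter (card≤? (suc d)) (List.map (inside ∷_) xs)) ≡
  List.length (List.filter (card≤? d) xs)
filter-≤-inside d = length-filter-map (card≤? (suc d)) (card≤? d) (inside ∷_) ℕ.s≤s⁻¹ s≤s

filter-≤0-inside : ∀ {n} (xs : List (Subset n)) →
  List.filter (card≤? 0) (List.map (inside ∷_) xs) ≡ []
filter-≤0-inside []       = refl
filter-≤0-inside (_ ∷ xs) = filter-≤0-inside xs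

support : ∀ n → ℕ → List (Subset n)
support n d = List.filter (card≤? d) (subsets n)

support-card : ∀ n d → All (λ S → card S ℕ.≤ d) (support n d)
support-card n d = AllP.all-filter (card≤? d) (subsets n)

support-split : ∀ n d → List.length (support (suc n) d) ≡
  List.length (support n d) ℕ.+
  List.length (List.filter (card≤? d) (List.map (inside ∷_) (subsets n)))
support-split n d = trans
  (cong List.length (ListP.filter-++ (card≤? d) (List.map (outside ∷_) (subsets n)) _))
  (trans (ListP.length-++ (List.filter (card≤? d) (List.map (outside ∷_) (subsets n))))
    (cong₂ ℕ._+_ (filter-≤-outside d (subsets n)) refl))

-- Splitting on the first element gives Pascal's recursion. The induction closes because (n+1)^(d+1)
-- + (n+1)^d = (n+2) (n+1)^d, which is at most (n+2)^(d+1).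
length-support : ∀ n d → List.length (support n d) ℕ.≤ suc n ℕ.^ d
length-support zero    d       = ℕP.≤-reflexive (sym (ℕP.^-zeroˡ d))
length-support (suc n) zero    = ℕP.≤-trans
  (ℕP.≤-reflexive (trans (support-split n 0)
    (trans (cong (λ xs → List.length (support n 0) ℕ.+ List.length xs)
                 (filter-≤0-inside (subsets n)))
           (ℕP.+-identityʳ _))))
  (length-support n zero)
length-support (suc n) (suc d) = begin
  List.length (support (suc n) (suc d))
    ≡⟨ trans (support-split n (suc d))
         (cong (List.length (support n (suc d)) ℕ.+_) (filter-≤-inside d (subsets n))) ⟩
  List.length (support n (suc d)) ℕ.+ List.length (support n d)
    ≤⟨ ℕP.+-mono-≤ (length-support n (suc d)) (length-support n d) ⟩
  suc n ℕ.^ suc d ℕ.+ suc n ℕ.^ d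
    ≡⟨ ℕP.+-comm (suc n ℕ.^ suc d) (suc n ℕ.^ d) ⟩
  suc (suc n) ℕ.* suc n ℕ.^ d
    ≤⟨ ℕP.*-monoʳ-≤ (suc (suc n)) (ℕP.^-monoˡ-≤ d (ℕP.n≤1+n (suc n))) ⟩
  suc (suc n) ℕ.^ suc d ∎
  where open ℕP.≤-Reasoning

-- `Subset n` and `Cube n` are the same boolean vectors, so this one vector serves both as the
-- standard set of size `k`, at which a symmetric coefficient is read, and as the standard point of
-- weight `k`, at which a polynomial is evaluated.
initial : ∀ n → ℕ → Subset n
initial zero    _       = []
initial (suc n) zero    = outside ∷ initial n zero
initial (suc n) (suc k) = inside ∷ initial n k

card-initial : ∀ n k → k ℕ.≤ n → card (initial n k) ≡ k
card-initial zero    zero    _         = refl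
card-initial (suc n) zero    _         = card-initial n zero z≤n
card-initial (suc n) (suc k) (s≤s k≤n) = cong suc (card-initial n k k≤n)

weight-initial : ∀ n k → k ℕ.≤ n → weight (initial n k) ≡ k
weight-initial zero    zero    _         = refl
weight-initial (suc n) zero    _         = weight-initial n zero z≤n
weight-initial (suc n) (suc k) (s≤s k≤n) = cong suc (weight-initial n k k≤n)

∑ℤ : ∀ {A : Set} → List A → (A → ℤ) → ℤ
∑ℤ xs f = List.foldr (λ a s → f a ℤ.+ s) 0ℤ xs

-- Indexing coefficients by cardinality builds symmetry in: the polynomial is determined by the d +
-- 1 integers `b 0`, ..., `b d`, and these are what the pigeonhole argument counts.
polynomialℤ : ∀ {n} → ℕ → (ℕ → ℤ) → Cube n → ℤ
polynomialℤ {n} d b x = ∑ℤ (support n d) (λ S → b (card S) ℤ.* + monomial S x)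

-- Interchange of summations. It identifies the polynomial with combined coefficients with the
-- combination of the values, so that divisibility passes from coefficients to values.
∑ℤ-linear : ∀ {A : Set} {m} (xs : List A) (E : Fin m → ℤ) (b : Fin m → A → ℤ) (μ : A → ℤ) →
  ∑ℤ xs (λ a → sum (λ w → E w ℤ.* b w a) ℤ.* μ a) ≡
  sum (λ w → E w ℤ.* ∑ℤ xs (λ a → b w a ℤ.* μ a))
∑ℤ-linear {m = m} [] E b μ = sym (trans (sum-cong-≗ (λ w → ℤP.*-zeroʳ (E w)))
  (sum-replicate-zero m))
∑ℤ-linear (a ∷ xs) E b μ = begin
  sum (λ w → E w ℤ.* b w a) ℤ.* μ a ℤ.+ ∑ℤ xs (λ a → sum (λ w → E w ℤ.* b w a) ℤ.* μ a)
    ≡⟨ cong₂ ℤ._+_ (*-distribʳ-sum (μ a) (λ w → E w ℤ.* b w a)) (∑ℤ-linear xs E b μ) ⟩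
  sum (λ w → E w ℤ.* b w a ℤ.* μ a) ℤ.+ sum (λ w → E w ℤ.* ∑ℤ xs (λ a → b w a ℤ.* μ a))
    ≡⟨ sym (∑-distrib-+ (λ w → E w ℤ.* b w a ℤ.* μ a) _) ⟩
  sum (λ w → E w ℤ.* b w a ℤ.* μ a ℤ.+ E w ℤ.* ∑ℤ xs (λ a → b w a ℤ.* μ a))
    ≡⟨ sum-cong-≗ (λ w → trans (cong (ℤ._+ _) (ℤP.*-assoc (E w) (b w a) (μ a)))
                       (sym (ℤP.*-distribˡ-+ (E w) _ _))) ⟩
  sum (λ w → E w ℤ.* (b w a ℤ.* μ a ℤ.+ ∑ℤ xs (λ a → b w a ℤ.* μ a))) ∎
  where open ≡-Reasoning

∑ℤ-∣ : ∀ {A : Set} {P : A → Set} {k} {xs : List A} (f : A → ℤ) → All P xs →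
  (∀ {a} → P a → k ∣ f a) → k ∣ ∑ℤ xs f
∑ℤ-∣ f []         h = divides 0ℤ refl
∑ℤ-∣ f (px ∷ pxs) h = ℤD.∣m∣n⇒∣m+n (h px) (∑ℤ-∣ f pxs h)

-- Integer relations from the pigeonhole principle

%ℕ-≡⇒∣- : ∀ a b m .{{_ : ℕ.NonZero m}} → a ℤDM.%ℕ m ≡ b ℤDM.%ℕ m → + m ∣ a ℤ.- b
%ℕ-≡⇒∣- a b m eq = divides (a ℤDM./ℕ m ℤ.- b ℤDM./ℕ m) (begin
  a ℤ.- b ≡⟨ cong₂ ℤ._-_ (ℤDM.a≡a%ℕn+[a/ℕn]*n a m) (ℤDM.a≡a%ℕn+[a/ℕn]*n b m) ⟩
  (+ (a ℤDM.%ℕ m) ℤ.+ q ℤ.* + m) ℤ.- (+ (b ℤDM.%ℕ m) ℤ.+ r ℤ.* + m)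
    ≡⟨ cong (λ t → (+ t ℤ.+ q ℤ.* + m) ℤ.- (+ (b ℤDM.%ℕ m) ℤ.+ r ℤ.* + m)) eq ⟩
  (+ (b ℤDM.%ℕ m) ℤ.+ q ℤ.* + m) ℤ.- (+ (b ℤDM.%ℕ m) ℤ.+ r ℤ.* + m)
    ≡⟨ solve 4 (λ s q r m → (s :+ q :* m) :- (s :+ r :* m) := (q :- r) :* m) refl
         (+ (b ℤDM.%ℕ m)) q r (+ m) ⟩
  (q ℤ.- r) ℤ.* + m ∎)
  where
  open ≡-Reasoning
  open ℤS.+-*-Solver
  q = a ℤDM./ℕ m
  r = b ℤDM./ℕ m

-- As in Siegel's lemma: two of the 2 ^ N sums over subsets of b agree in all D residues.
bit-relation : ∀ N D M .{{_ : ℕ.NonZero M}} → M ℕ.^ D ℕ.< 2 ℕ.^ N → (b : Fin N → ℕ → ℤ) →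
  Σ[ E ∈ (Fin N → ℤ) ] ((∀ w → ℤ.∣ E w ∣ ℕ.≤ 1) × (∃[ w ] ℤ.∣ E w ∣ ≡ 1) ×
    (∀ k → k ℕ.< D → + M ∣ sum (λ w → E w ℤ.* b w k)))
bit-relation N D M lt b = E , E≤1 , nontrivial , relation
  where
  combination : (Fin N → Fin 2) → ℕ → ℤ
  combination T k = sum (λ w → + toℕ (T w) ℤ.* b w k)
  residues : (Fin N → Fin 2) → Fin D → Fin M
  residues T k = fromℕ< (ℤDM.n%ℕd<d (combination T (toℕ k)) M)
  -- Subsets are coded by numbers below 2 ^ N and residue vectors by numbers below M ^ D, which
  -- turns the count into a comparison of two finite ordinals.
  collision = FinP.pigeonhole lt (λ i → funToFin (residues (finToFun i)))
  i = proj₁ collision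
  j = proj₁ (proj₂ collision)
  i<j = proj₁ (proj₂ (proj₂ collision))
  T T′ : Fin N → Fin 2
  T = finToFun i
  T′ = finToFun j
  E : Fin N → ℤ
  E w = + toℕ (T w) ℤ.- + toℕ (T′ w)

  bit-difference-≤1 : ∀ (s t : Fin 2) → ℤ.∣ + toℕ s ℤ.- + toℕ t ∣ ℕ.≤ 1
  bit-difference-≤1 zero       zero       = z≤n
  bit-difference-≤1 zero       (suc zero) = s≤s z≤n
  bit-difference-≤1 (suc zero) zero       = s≤s z≤n
  bit-difference-≤1 (suc zero) (suc zero) = z≤n

  bit-difference-≢ : ∀ (s t : Fin 2) → s ≢ t → ℤ.∣ + toℕ s ℤ.- + toℕ t ∣ ≡ 1
  bit-difference-≢ zero       zero       s≢t = contradiction refl s≢t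
  bit-difference-≢ zero       (suc zero) _   = refl
  bit-difference-≢ (suc zero) zero       _   = refl
  bit-difference-≢ (suc zero) (suc zero) s≢t = contradiction refl s≢t

  E≤1 : ∀ w → ℤ.∣ E w ∣ ℕ.≤ 1
  E≤1 w = bit-difference-≤1 (T w) (T′ w)

  funToFin-cong : ∀ {m k} {f g : Fin m → Fin k} → f ≗ g → funToFin f ≡ funToFin g
  funToFin-cong {zero}  h = refl
  funToFin-cong {suc m} h = cong₂ Fin.combine (h zero) (funToFin-cong (h ∘ suc))

  -- Each code is recovered from the subset it decodes to, so distinct codes give distinct subsets.
  T≢T′ : ¬ (∀ w → T w ≡ T′ w)
  T≢T′ eq = FinP.<-irrefl (trans (sym (FinP.funToFin-finToFin {N} {2} i))
    (trans (funToFin-cong eq) (FinP.funToFin-finToFin {N} {2} j))) i<j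

  nontrivial : ∃[ w ] ℤ.∣ E w ∣ ≡ 1
  nontrivial with FinP.¬∀⟶∃¬ N (λ w → T w ≡ T′ w) (λ w → T w FinP.≟ T′ w) T≢T′
  ... | w , neq = w , bit-difference-≢ (T w) (T′ w) neq

  residues-≗ : residues T ≗ residues T′
  residues-≗ k = trans (sym (FinP.finToFun-funToFin (residues T) k))
    (trans (cong (λ c → finToFun c k) (proj₂ (proj₂ (proj₂ collision))))
      (FinP.finToFun-funToFin (residues T′) k))

  residue-≡ : ∀ k → k ℕ.< D → combination T k ℤDM.%ℕ M ≡ combination T′ k ℤDM.%ℕ M
  residue-≡ k k<D = subst (λ k → combination T k ℤDM.%ℕ M ≡ combination T′ k ℤDM.%ℕ M)
    (FinP.toℕ-fromℕ< k<D)
    (trans (sym (FinP.toℕ-fromℕ< _)) (trans (cong toℕ (residues-≗ (fromℕ< k<D))) (FinP.toℕ-fromℕ< _)))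

  combination-E : ∀ k → sum (λ w → E w ℤ.* b w k) ≡ combination T k ℤ.- combination T′ k
  combination-E k = begin
    sum (λ w → E w ℤ.* b w k)
      -- The subtraction becomes the addition of a multiple of -1, so that additivity and scaling of
      -- `sum` apply.
      ≡⟨ sum-cong-≗ (λ w → solve 3 (λ s t b → (s :- t) :* b := s :* b :+ con (ℤ.- 1ℤ) :* (t :* b)) refl
           (+ toℕ (T w)) (+ toℕ (T′ w)) (b w k)) ⟩
    sum (λ w → + toℕ (T w) ℤ.* b w k ℤ.+ ℤ.- 1ℤ ℤ.* (+ toℕ (T′ w) ℤ.* b w k))
      ≡⟨ ∑-distrib-+ (λ w → + toℕ (T w) ℤ.* b w k) _ ⟩
    combination T k ℤ.+ sum (λ w → ℤ.- 1ℤ ℤ.* (+ toℕ (T′ w) ℤ.* b w k))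
      ≡⟨ cong (λ t → combination T k ℤ.+ t) (sym (*-distribˡ-sum (ℤ.- 1ℤ) (λ w → + toℕ (T′ w) ℤ.* b w k))) ⟩
    combination T k ℤ.+ ℤ.- 1ℤ ℤ.* combination T′ k
      ≡⟨ cong (λ t → combination T k ℤ.+ t) (ℤP.-1*i≡-i (combination T′ k)) ⟩
    combination T k ℤ.- combination T′ k ∎
    where
    open ≡-Reasoning
    open ℤS.+-*-Solver

  relation : ∀ k → k ℕ.< D → + M ∣ sum (λ w → E w ℤ.* b w k)
  relation k k<D = subst (+ M ∣_) (sym (combination-E k))
    (%ℕ-≡⇒∣- (combination T k) (combination T′ k) M (residue-≡ k k<D))

-- Integers close to multiples of a modulus

-- Scaling by N keeps the error bound R / N integral.
record Near (N M R : ℕ) (z : ℤ) : Set where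
  constructor near
  field
    multiple : ℤ
    distance : N ℕ.* ℤ.∣ z ℤ.- multiple ℤ.* + M ∣ ℕ.≤ R

module _ {N M : ℕ} where

  near-+ : ∀ {R R′ a b} → Near N M R a → Near N M R′ b → Near N M (R ℕ.+ R′) (a ℤ.+ b)
  near-+ {R} {R′} {a} {b} (near k p) (near l q) = near (k ℤ.+ l) (begin
    N ℕ.* ℤ.∣ (a ℤ.+ b) ℤ.- (k ℤ.+ l) ℤ.* + M ∣
      ≡⟨ cong (λ t → N ℕ.* ℤ.∣ t ∣) (solve 5 (λ a b k l m →
           (a :+ b) :- (k :+ l) :* m := (a :- k :* m) :+ (b :- l :* m)) refl a b k l (+ M)) ⟩
    N ℕ.* ℤ.∣ (a ℤ.- k ℤ.* + M) ℤ.+ (b ℤ.- l ℤ.* + M) ∣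
      ≤⟨ ℕP.*-monoʳ-≤ N (ℤP.∣i+j∣≤∣i∣+∣j∣ (a ℤ.- k ℤ.* + M) (b ℤ.- l ℤ.* + M)) ⟩
    N ℕ.* (ℤ.∣ a ℤ.- k ℤ.* + M ∣ ℕ.+ ℤ.∣ b ℤ.- l ℤ.* + M ∣)
      ≡⟨ ℕP.*-distribˡ-+ N _ _ ⟩
    N ℕ.* ℤ.∣ a ℤ.- k ℤ.* + M ∣ ℕ.+ N ℕ.* ℤ.∣ b ℤ.- l ℤ.* + M ∣
      ≤⟨ ℕP.+-mono-≤ p q ⟩
    R ℕ.+ R′ ∎)
    where
    open ℕP.≤-Reasoning
    open ℤS.+-*-Solver

  near-* : ∀ {R a} e → ℤ.∣ e ∣ ℕ.≤ 1 → Near N M R a → Near N M R (e ℤ.* a)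
  near-* {R} {a} e e≤1 (near k p) = near (e ℤ.* k) (begin
    N ℕ.* ℤ.∣ e ℤ.* a ℤ.- e ℤ.* k ℤ.* + M ∣
      ≡⟨ cong (λ t → N ℕ.* ℤ.∣ t ∣) (solve 4 (λ e a k m →
           e :* a :- e :* k :* m := e :* (a :- k :* m)) refl e a k (+ M)) ⟩
    N ℕ.* ℤ.∣ e ℤ.* (a ℤ.- k ℤ.* + M) ∣
      ≡⟨ cong (N ℕ.*_) (ℤP.∣i*j∣≡∣i∣*∣j∣ e (a ℤ.- k ℤ.* + M)) ⟩
    N ℕ.* (ℤ.∣ e ∣ ℕ.* ℤ.∣ a ℤ.- k ℤ.* + M ∣)
      ≤⟨ ℕP.*-monoʳ-≤ N (ℕP.*-monoˡ-≤ _ e≤1) ⟩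
    N ℕ.* (1 ℕ.* ℤ.∣ a ℤ.- k ℤ.* + M ∣)
      ≡⟨ cong (N ℕ.*_) (ℕP.*-identityˡ _) ⟩
    N ℕ.* ℤ.∣ a ℤ.- k ℤ.* + M ∣
      ≤⟨ p ⟩
    R ∎)
    where
    open ℕP.≤-Reasoning
    open ℤS.+-*-Solver

  near-sum : ∀ {R m} (f : Vector ℤ m) → (∀ i → Near N M R (f i)) → Near N M (m ℕ.* R) (sum f)
  near-sum {m = zero}  f h = near 0ℤ (ℕP.≤-reflexive (ℕP.*-zeroʳ N))
  near-sum {m = suc m} f h = near-+ (h zero) (near-sum (f ∘ suc) (h ∘ suc))

  -- Negation and shifts by multiples of `M` preserve distances to multiples of `M`, and `c` is such
  -- a multiple.
  near-∣ : ∀ {R a c} → + M ∣ c → Near N M R (c ℤ.- a) → Near N M R a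
  near-∣ {R} {a} {c} (divides q eq) (near k p) = near (q ℤ.- k) (subst (λ t → N ℕ.* t ℕ.≤ R) (begin
    ℤ.∣ (c ℤ.- a) ℤ.- k ℤ.* + M ∣
      ≡⟨ cong (λ c → ℤ.∣ (c ℤ.- a) ℤ.- k ℤ.* + M ∣) eq ⟩
    ℤ.∣ (q ℤ.* + M ℤ.- a) ℤ.- k ℤ.* + M ∣
      ≡⟨ cong ℤ.∣_∣ (solve 4 (λ q k a m →
           (q :* m :- a) :- k :* m := :- (a :- (q :- k) :* m)) refl q k a (+ M)) ⟩
    ℤ.∣ ℤ.- (a ℤ.- (q ℤ.- k) ℤ.* + M) ∣
      ≡⟨ ℤP.∣-i∣≡∣i∣ (a ℤ.- (q ℤ.- k) ℤ.* + M) ⟩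
    ℤ.∣ a ℤ.- (q ℤ.- k) ℤ.* + M ∣ ∎) p)
    where
    open ≡-Reasoning
    open ℤS.+-*-Solver

2∤unit : ∀ e k → ℤ.∣ e ∣ ≡ 1 → 1 ℕ.≤ ℤ.∣ e ℤ.- k ℤ.* + 2 ∣
2∤unit e k ∣e∣≡1 = ℕP.n≢0⇒n>0 λ eq → 2∤1 (subst (2 ℕD.∣_) ∣e∣≡1
  (ℤD.∣⇒∣ᵤ {+ 2} {e} (divides k (ℤP.i-j≡0⇒i≡j e (k ℤ.* + 2) (ℤP.∣i∣≡0⇒i≡0 eq)))))
  where
  2∤1 : ¬ (2 ℕD.∣ 1)
  2∤1 d = contradiction (ℕD.∣⇒≤ d) λ { (s≤s ()) }

-- Here e H - k (2 H) = (e - 2 k) H, and e - 2 k is odd, hence nonzero. So modulo 2 H the number ± H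
-- keeps distance at least `H` from zero.
odd-multiple-far : ∀ {N H R} e → ℤ.∣ e ∣ ≡ 1 → Near N (H ℕ.* 2) R (e ℤ.* + H) → N ℕ.* H ℕ.≤ R
odd-multiple-far {N} {H} {R} e ∣e∣≡1 (near k p) = begin
  N ℕ.* H
    ≡⟨ cong (N ℕ.*_) (sym (ℕP.*-identityˡ H)) ⟩
  N ℕ.* (1 ℕ.* H)
    ≤⟨ ℕP.*-monoʳ-≤ N (ℕP.*-monoˡ-≤ H (2∤unit e k ∣e∣≡1)) ⟩
  N ℕ.* (ℤ.∣ e ℤ.- k ℤ.* + 2 ∣ ℕ.* H)
    ≡⟨ cong (N ℕ.*_) (sym (ℤP.∣i*j∣≡∣i∣*∣j∣ (e ℤ.- k ℤ.* + 2) (+ H))) ⟩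
  N ℕ.* ℤ.∣ (e ℤ.- k ℤ.* + 2) ℤ.* + H ∣
    ≡⟨ cong (λ t → N ℕ.* ℤ.∣ t ∣) (trans
         (solve 3 (λ e k h → (e :- k :* con (+ 2)) :* h := e :* h :- k :* (h :* con (+ 2))) refl e k (+ H))
         (cong (λ t → e ℤ.* + H ℤ.- k ℤ.* t) (sym (ℤP.pos-* H 2)))) ⟩
  N ℕ.* ℤ.∣ e ℤ.* + H ℤ.- k ℤ.* + (H ℕ.* 2) ∣
    ≤⟨ p ⟩
  R ∎
  where
  open ℕP.≤-Reasoning
  open ℤS.+-*-Solver

-- The Kronecker delta, phrased with `toℕ` so that it has the form `Δ` takes at a point once the
-- weight of that point is known.
δ : ∀ {m} → Fin m → Fin m → ℕ
δ w v = bit (does (toℕ w ℕP.≟ toℕ v))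

δ-refl : ∀ {m} (w : Fin m) → δ w w ≡ 1
δ-refl w = cong bit (dec-true (toℕ w ℕP.≟ toℕ w) refl)

δ-≢ : ∀ {m} {w v : Fin m} → w ≢ v → δ w v ≡ 0
δ-≢ {w = w} {v} w≢v = cong bit (dec-false (toℕ w ℕP.≟ toℕ v) (w≢v ∘ FinP.toℕ-injective))

-- Modulo 2 H all summands but the v-th are small, and the v-th is close to ± H.
no-relation : ∀ {m N H R} (E : Fin (suc m) → ℤ) (p : Fin (suc m) → Fin (suc m) → ℤ) →
  (∀ w v → Near N (H ℕ.* 2) R (p w v ℤ.- + (H ℕ.* δ v w))) →
  (∀ w → ℤ.∣ E w ∣ ℕ.≤ 1) → ∀ v → ℤ.∣ E v ∣ ≡ 1 →
  + (H ℕ.* 2) ∣ sum (λ w → E w ℤ.* p w v) → N ℕ.* H ℕ.≤ suc m ℕ.* R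
no-relation {m} {N} {H} {R} E p close E≤1 v ∣Ev∣≡1 M∣sum =
  odd-multiple-far (E v) ∣Ev∣≡1 (near-∣ M∣sum (subst (Near N (H ℕ.* 2) (suc m ℕ.* R)) eq
    -- The errors add up to `R` for the summand at `v` and `m * R` for the others.
    (near-+ at-v (near-sum (removeAt f v) off-v))))
  where
  f : Fin (suc m) → ℤ
  f w = E w ℤ.* p w v
  at-v : Near N (H ℕ.* 2) R (E v ℤ.* (p v v ℤ.- + H))
  at-v = near-* (E v) (E≤1 v) (subst (λ h → Near N (H ℕ.* 2) R (p v v ℤ.- + h))
    (trans (cong (H ℕ.*_) (δ-refl v)) (ℕP.*-identityʳ H)) (close v v))
  off-v : ∀ i → Near N (H ℕ.* 2) R (removeAt f v i)
  off-v i = near-* (E w) (E≤1 w) (subst (Near N (H ℕ.* 2) R)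
    (trans (cong (λ h → p w v ℤ.- + h)
             (trans (cong (H ℕ.*_) (δ-≢ {w = v} (FinP.punchInᵢ≢i v i ∘ sym))) (ℕP.*-zeroʳ H)))
           (ℤP.+-identityʳ (p w v)))
    (close w v))
    where w = punchIn v i
  eq : E v ℤ.* (p v v ℤ.- + H) ℤ.+ sum (removeAt f v) ≡ sum f ℤ.- E v ℤ.* + H
  eq = trans
    (solve 4 (λ e p h s → e :* (p :- h) :+ s := (e :* p :+ s) :- e :* h) refl
      (E v) (p v v) (+ H) (sum (removeAt f v)))
    (cong (λ t → t ℤ.- E v ℤ.* + H) (sym (sum-remove {i = v} f)))
    where open ℤS.+-*-Solver

-- From reals to integers

toℚ : ℤ → ℚ
toℚ i = i ℚ./ 1

toℚ-≃ : ∀ i → ℚ.toℚᵘ (toℚ i) ℚᵘ.≃ ℚᵘ.mkℚᵘ i 0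
toℚ-≃ i = ℚP.toℚᵘ-fromℚᵘ (ℚᵘ.mkℚᵘ i 0)

toℚ-+ : ∀ i j → toℚ (i ℤ.+ j) ≡ toℚ i ℚ.+ toℚ j
toℚ-+ i j = ℚP.toℚᵘ-injective (begin
  ℚ.toℚᵘ (toℚ (i ℤ.+ j))              ≈⟨ toℚ-≃ (i ℤ.+ j) ⟩
  ℚᵘ.mkℚᵘ (i ℤ.+ j) 0                 ≈⟨ ℚᵘ.*≡* (solve 2 (λ i j →
    (i :+ j) :* con 1ℤ := (i :* con 1ℤ :+ j :* con 1ℤ) :* con 1ℤ) refl i j) ⟩
  ℚᵘ.mkℚᵘ i 0 ℚᵘ.+ ℚᵘ.mkℚᵘ j 0        ≈⟨ ℚᵘP.+-cong (ℚᵘP.≃-sym (toℚ-≃ i)) (ℚᵘP.≃-sym (toℚ-≃ j)) ⟩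
  ℚ.toℚᵘ (toℚ i) ℚᵘ.+ ℚ.toℚᵘ (toℚ j)  ≈⟨ ℚᵘP.≃-sym (ℚP.toℚᵘ-homo-+ (toℚ i) (toℚ j)) ⟩
  ℚ.toℚᵘ (toℚ i ℚ.+ toℚ j)            ∎)
  where
  open import Relation.Binary.Reasoning.Setoid ℚᵘP.≃-setoid
  open ℤS.+-*-Solver

toℚ-* : ∀ i j → toℚ (i ℤ.* j) ≡ toℚ i ℚ.* toℚ j
toℚ-* i j = ℚP.toℚᵘ-injective (begin
  ℚ.toℚᵘ (toℚ (i ℤ.* j))              ≈⟨ toℚ-≃ (i ℤ.* j) ⟩
  ℚᵘ.mkℚᵘ i 0 ℚᵘ.* ℚᵘ.mkℚᵘ j 0        ≈⟨ ℚᵘP.*-cong (ℚᵘP.≃-sym (toℚ-≃ i)) (ℚᵘP.≃-sym (toℚ-≃ j)) ⟩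
  ℚ.toℚᵘ (toℚ i) ℚᵘ.* ℚ.toℚᵘ (toℚ j)  ≈⟨ ℚᵘP.≃-sym (ℚP.toℚᵘ-homo-* (toℚ i) (toℚ j)) ⟩
  ℚ.toℚᵘ (toℚ i ℚ.* toℚ j)            ∎)
  where open import Relation.Binary.Reasoning.Setoid ℚᵘP.≃-setoid

toℚ-neg : ∀ i → toℚ (ℤ.- i) ≡ ℚ.- toℚ i
toℚ-neg i = ℚP.toℚᵘ-injective (begin
  ℚ.toℚᵘ (toℚ (ℤ.- i))      ≈⟨ toℚ-≃ (ℤ.- i) ⟩
  ℚᵘ.- ℚᵘ.mkℚᵘ i 0          ≈⟨ ℚᵘP.-‿cong (ℚᵘP.≃-sym (toℚ-≃ i)) ⟩
  ℚᵘ.- ℚ.toℚᵘ (toℚ i)       ≈⟨ ℚᵘP.≃-sym (ℚP.toℚᵘ-homo‿- (toℚ i)) ⟩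
  ℚ.toℚᵘ (ℚ.- toℚ i)        ∎)
  where open import Relation.Binary.Reasoning.Setoid ℚᵘP.≃-setoid

toℚ-∣∣ : ∀ i → ℚ.∣ toℚ i ∣ ≡ toℚ (+ ℤ.∣ i ∣)
toℚ-∣∣ i = ℚP.toℚᵘ-injective (begin
  ℚ.toℚᵘ ℚ.∣ toℚ i ∣        ≈⟨ ℚP.toℚᵘ-homo-∣-∣ (toℚ i) ⟩
  ℚᵘ.∣ ℚ.toℚᵘ (toℚ i) ∣     ≈⟨ ℚᵘP.∣-∣-cong (toℚ-≃ i) ⟩
  ℚᵘ.mkℚᵘ (+ ℤ.∣ i ∣) 0     ≈⟨ ℚᵘP.≃-sym (toℚ-≃ (+ ℤ.∣ i ∣)) ⟩
  ℚ.toℚᵘ (toℚ (+ ℤ.∣ i ∣))  ∎)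
  where open import Relation.Binary.Reasoning.Setoid ℚᵘP.≃-setoid

toℚ-mono-≤ : ∀ {i j} → i ℤ.≤ j → toℚ i ℚ.≤ toℚ j
toℚ-mono-≤ {i} {j} h = ℚP.toℚᵘ-cancel-≤
  (ℚᵘP.≤-respʳ-≃ (ℚᵘP.≃-sym (toℚ-≃ j)) (ℚᵘP.≤-respˡ-≃ (ℚᵘP.≃-sym (toℚ-≃ i))
    (ℚᵘ.*≤* (ℤP.*-monoʳ-≤-nonNeg 1ℤ h))))

toℚ-cancel-≤ : ∀ {i j} → toℚ i ℚ.≤ toℚ j → i ℤ.≤ j
toℚ-cancel-≤ {i} {j} h = ℤP.*-cancelʳ-≤-pos i j 1ℤ (ℚᵘP.drop-*≤*
  (ℚᵘP.≤-respʳ-≃ (toℚ-≃ j) (ℚᵘP.≤-respˡ-≃ (toℚ-≃ i) (ℚP.toℚᵘ-mono-≤ h))))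

/-*-cancel : ∀ i k .{{_ : ℕ.NonZero k}} → (i ℚ./ k) ℚ.* toℚ (+ k) ≡ toℚ i
/-*-cancel i k@(suc k-1) = ℚP.toℚᵘ-injective (begin
  ℚ.toℚᵘ ((i ℚ./ k) ℚ.* toℚ (+ k))            ≈⟨ ℚP.toℚᵘ-homo-* (i ℚ./ k) (toℚ (+ k)) ⟩
  ℚ.toℚᵘ (i ℚ./ k) ℚᵘ.* ℚ.toℚᵘ (toℚ (+ k))
    ≈⟨ ℚᵘP.*-cong (ℚP.toℚᵘ-fromℚᵘ (ℚᵘ.mkℚᵘ i k-1)) (toℚ-≃ (+ k)) ⟩
  ℚᵘ.mkℚᵘ i k-1 ℚᵘ.* ℚᵘ.mkℚᵘ (+ k) 0          ≈⟨ ℚᵘ.*≡* (ℤP.*-assoc i (+ k) 1ℤ) ⟩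
  ℚᵘ.mkℚᵘ i 0                                 ≈⟨ ℚᵘP.≃-sym (toℚ-≃ i) ⟩
  ℚ.toℚᵘ (toℚ i)                              ∎)
  where open import Relation.Binary.Reasoning.Setoid ℚᵘP.≃-setoid

∣+∣≤ : ∀ {a b r s} → ℚ.∣ a ∣ ℚ.≤ r → ℚ.∣ b ∣ ℚ.≤ s → ℚ.∣ a ℚ.+ b ∣ ℚ.≤ r ℚ.+ s
∣+∣≤ {a} {b} h k = ℚP.≤-trans (ℚP.∣p+q∣≤∣p∣+∣q∣ a b) (ℚP.+-mono-≤ h k)

∣*∣≤ : ∀ {a b r s} → ℚ.∣ a ∣ ℚ.≤ r → ℚ.∣ b ∣ ℚ.≤ s → ℚ.∣ a ℚ.* b ∣ ℚ.≤ r ℚ.* s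
∣*∣≤ {a} {b} {r} {s} h k = subst (ℚ._≤ r ℚ.* s) (sym (ℚP.∣p*q∣≡∣p∣*∣q∣ a b))
  (ℚP.≤-trans (ℚP.*-monoʳ-≤-nonNeg ℚ.∣ b ∣ {{ℚP.∣-∣-nonNeg b}} h)
    (ℚP.*-monoˡ-≤-nonNeg r {{ℚ.nonNegative (ℚP.≤-trans (ℚP.0≤∣p∣ a) h)}} k))

∣toℚ∣≤ : ∀ {i m} → ℤ.∣ i ∣ ℕ.≤ m → ℚ.∣ toℚ i ∣ ℚ.≤ toℚ (+ m)
∣toℚ∣≤ {i} {m} h = subst (ℚ._≤ toℚ (+ m)) (sym (toℚ-∣∣ i)) (toℚ-mono-≤ (ℤ.+≤+ h))

-- Multiplied by the denominator of `q`, the difference becomes minus the remainder of the division,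
-- whose size is below that denominator.
floor-close : ∀ q → ℚ.∣ toℚ (ℚ.floor q) ℚ.- q ∣ ℚ.≤ 1ℚ
floor-close q@record{} = ℚP.*-cancelʳ-≤-pos D {{D>0}} (begin
  ℚ.∣ toℚ f ℚ.- q ∣ ℚ.* D          ≡⟨ cong (ℚ.∣ toℚ f ℚ.- q ∣ ℚ.*_) (sym (toℚ-∣∣ (ℚ.↧ q))) ⟩
  ℚ.∣ toℚ f ℚ.- q ∣ ℚ.* ℚ.∣ D ∣    ≡⟨ sym (ℚP.∣p*q∣≡∣p∣*∣q∣ (toℚ f ℚ.- q) D) ⟩
  ℚ.∣ (toℚ f ℚ.- q) ℚ.* D ∣        ≡⟨ cong ℚ.∣_∣ eq ⟩
  ℚ.∣ ℚ.- toℚ (+ r) ∣              ≡⟨ ℚP.∣-p∣≡∣p∣ (toℚ (+ r)) ⟩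
  ℚ.∣ toℚ (+ r) ∣                  ≤⟨ ∣toℚ∣≤ {+ r} (ℕP.<⇒≤ (ℤDM.n%d<d (ℚ.↥ q) (ℚ.↧ q))) ⟩
  D                                ≡⟨ sym (ℚP.*-identityˡ D) ⟩
  1ℚ ℚ.* D                         ∎)
  where
  open ℚP.≤-Reasoning
  D = toℚ (ℚ.↧ q)
  f = ℚ.floor q
  r = ℚ.↥ q ℤDM.% ℚ.↧ q
  D>0 : ℚ.Positive D
  D>0 = ℚP.normalize-pos (ℚ.↧ₙ q) 1
  qD : q ℚ.* D ≡ toℚ (+ r) ℚ.+ toℚ f ℚ.* D
  qD = trans (cong (ℚ._* D) (sym (ℚP.↥p/↧p≡p q)))
    (trans (/-*-cancel (ℚ.↥ q) (ℚ.↧ₙ q))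
      (trans (cong toℚ (ℤDM.a≡a%n+[a/n]*n (ℚ.↥ q) (ℚ.↧ q)))
        (trans (toℚ-+ (+ r) (f ℤ.* ℚ.↧ q)) (cong (toℚ (+ r) ℚ.+_) (toℚ-* f (ℚ.↧ q))))))
  eq : (toℚ f ℚ.- q) ℚ.* D ≡ ℚ.- toℚ (+ r)
  eq = trans (solve 3 (λ f q d → (f :- q) :* d := f :* d :- q :* d) refl (toℚ f) q D)
    (trans (cong (λ t → toℚ f ℚ.* D ℚ.- t) qD)
      (solve 2 (λ a r → a :- (r :+ a) := :- r) refl (toℚ f ℚ.* D) (toℚ (+ r))))
    where open ℚS.+-*-Solver

-- Real inequalities read at a common index

Eventually : (ℕ → Set) → Set
Eventually P = ∃[ N ] (∀ m → N ℕ.≤ m → P m)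

_∧ᴱ_ : ∀ {P Q : ℕ → Set} → Eventually P → Eventually Q → Eventually (λ m → P m × Q m)
(M , p) ∧ᴱ (N , q) = M ℕ.⊔ N , λ m h →
  p m (ℕP.m⊔n≤o⇒m≤o M N h) , q m (ℕP.m⊔n≤o⇒n≤o M N h)

-- Finitely many thresholds have a common upper bound. Families indexed by `Subset n` are covered as
-- well, that being the same type of vectors.
eventually-cube : ∀ {n} {P : Cube n → ℕ → Set} →
  (∀ x → Eventually (P x)) → Eventually (λ m → ∀ x → P x m)
eventually-cube {zero}  h with h []
... | N , p = N , λ { m N≤m [] → p m N≤m }
eventually-cube {suc n} h
  with eventually-cube (λ x → h (false ∷ x)) ∧ᴱ eventually-cube (λ x → h (true ∷ x))
... | N , p = N , λ { m N≤m (false ∷ x) → proj₁ (p m N≤m) x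
                    ; m N≤m (true ∷ x)  → proj₂ (p m N≤m) x }

≃⇒close : ∀ {x y} ε → 0ℚ ℚ.< ε → x ≃ y → Eventually (λ m → ℚ.∣ seq x m ℚ.- seq y m ∣ ℚ.≤ ε)
≃⇒close ε 0<ε (x≤y , y≤x) = map₂ (λ p m N≤m → ∣∣≤ (proj₁ (p m N≤m)) (proj₂ (p m N≤m)))
  (x≤y ε 0<ε ∧ᴱ y≤x ε 0<ε)

≤-maxCube : ∀ {n} (F : Cube n → ℝ) x m → seq (F x) m ℚ.≤ seq (maxCube F) m
≤-maxCube F []          m = ℚP.≤-refl
≤-maxCube F (false ∷ x) m = ℚP.≤-trans (≤-maxCube (λ x → F (false ∷ x)) x m)
  (ℚP.p≤p⊔q (seq (maxCube (λ x → F (false ∷ x))) m) _)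
≤-maxCube F (true ∷ x)  m = ℚP.≤-trans (≤-maxCube (λ x → F (true ∷ x)) x m)
  (ℚP.p≤q⊔p (seq (maxCube (λ x → F (false ∷ x))) m) _)

∣∣≤seq-∣∣ : ∀ x m → ℚ.∣ seq x m ∣ ℚ.≤ seq ∣ x ∣ m
∣∣≤seq-∣∣ x m with ℚP.∣p∣≡p∨∣p∣≡-p (seq x m)
... | inj₁ eq = ℚP.≤-trans (ℚP.≤-reflexive eq) (ℚP.p≤p⊔q (seq x m) _)
... | inj₂ eq = ℚP.≤-trans (ℚP.≤-reflexive eq) (ℚP.p≤q⊔p (seq x m) _)

monomial≤1 : ∀ {n} (S : Subset n) x → monomial S x ℕ.≤ 1
monomial≤1 []            []          = ℕP.≤-refl
monomial≤1 (outside ∷ S) (_ ∷ x)     = monomial≤1 S x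
monomial≤1 (inside  ∷ S) (false ∷ x) = z≤n
monomial≤1 (inside  ∷ S) (true ∷ x)  = ℕP.≤-trans (ℕP.≤-reflexive (ℕP.*-identityˡ _)) (monomial≤1 S x)

-- Monomials take only the values 0 and 1, so each term contributes at most the error `r` of its own
-- coefficient.
∑-rounding : ∀ {A : Set} (M : ℚ) m r (xs : List A) (c : A → ℤ) (P : A → ℝ) (μ : A → ℕ) →
  (∀ a → ℚ.∣ toℚ (c a) ℚ.- M ℚ.* seq (P a) m ∣ ℚ.≤ toℚ (+ r)) → (∀ a → μ a ℕ.≤ 1) →
  ℚ.∣ toℚ (∑ℤ xs (λ a → c a ℤ.* + μ a)) ℚ.- M ℚ.* seq (∑ xs (λ a → P a * fromℕ (μ a))) m ∣
    ℚ.≤ toℚ (+ (List.length xs ℕ.* r))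
∑-rounding M m r []       c P μ close μ≤1 = ℚP.≤-reflexive
  (cong ℚ.∣_∣ (trans (cong (λ t → 0ℚ ℚ.- t) (ℚP.*-zeroʳ M)) (ℚP.+-inverseʳ 0ℚ)))
∑-rounding M m r (a ∷ xs) c P μ close μ≤1 = begin
  ℚ.∣ toℚ (c a ℤ.* + μ a ℤ.+ s) ℚ.- M ℚ.* (u ℚ.* t ℚ.+ y) ∣
    ≡⟨ cong ℚ.∣_∣ (trans
         (cong (ℚ._- M ℚ.* (u ℚ.* t ℚ.+ y))
           (trans (toℚ-+ (c a ℤ.* + μ a) s) (cong (ℚ._+ toℚ s) (toℚ-* (c a) (+ μ a)))))
         (solve 6 (λ c t s M u y → (c :* t :+ s) :- M :* (u :* t :+ y) :=
           (c :- M :* u) :* t :+ (s :- M :* y)) refl (toℚ (c a)) t (toℚ s) M u y)) ⟩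
  ℚ.∣ (toℚ (c a) ℚ.- M ℚ.* u) ℚ.* t ℚ.+ (toℚ s ℚ.- M ℚ.* y) ∣
    ≤⟨ ∣+∣≤ {(toℚ (c a) ℚ.- M ℚ.* u) ℚ.* t} (∣*∣≤ {toℚ (c a) ℚ.- M ℚ.* u} (close a) (∣toℚ∣≤ {+ μ a} (μ≤1 a)))
         (∑-rounding M m r xs c P μ close μ≤1) ⟩
  toℚ (+ r) ℚ.* 1ℚ ℚ.+ toℚ (+ (List.length xs ℕ.* r))
    ≡⟨ cong (ℚ._+ toℚ (+ (List.length xs ℕ.* r))) (ℚP.*-identityʳ (toℚ (+ r))) ⟩
  toℚ (+ r) ℚ.+ toℚ (+ (List.length xs ℕ.* r))
    ≡⟨ sym (toℚ-+ (+ r) (+ (List.length xs ℕ.* r))) ⟩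
  toℚ (+ (r ℕ.+ List.length xs ℕ.* r)) ∎
  where
  open ℚP.≤-Reasoning
  open ℚS.+-*-Solver
  u = seq (P a) m
  t = toℚ (+ μ a)
  s = ∑ℤ xs (λ a → c a ℤ.* + μ a)
  y = seq (∑ xs (λ a → P a * fromℕ (μ a))) m

∣∣-cong-≤ : ∀ {a b r} → a ≡ b → ℚ.∣ a ∣ ℚ.≤ r → ℚ.∣ b ∣ ℚ.≤ r
∣∣-cong-≤ refl h = h

½bit : Bool → ℝ
½bit b = fromℚ (+ bit b ℚ./ 2)

-- The common Cauchy index m at which all coefficients and all values are read is
-- chosen so that each limit is approached up to 1 / M.
integral-coefficients : ∀ {n} d H .{{_ : ℕ.NonZero H}} N
  (ε₀ : ℝ) → (∀ m → seq ε₀ m ℚ.* toℚ (+ N) ≡ 1ℚ) → (f : Cube n → Bool) (Q : Cube n → 𝕋) →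
  IsSymmetricTorusPolynomial d Q → Q Approximates[ ε₀ ] f →
  Σ[ b ∈ (ℕ → ℤ) ] (∀ x →
    Near N (H ℕ.* 2) (H ℕ.* 2 ℕ.+ N ℕ.* (3 ℕ.+ List.length (support n d) ℕ.* 2))
      (polynomialℤ d b x ℤ.- + (H ℕ.* bit (f x))))
integral-coefficients {n} d H N ε₀ ε₀N f Q (P , P-sym , Q≈P) (ι , rep , bound) = b , close-at
  where
  M = H ℕ.* 2
  L = List.length (support n d)
  instance
    _ = ℕP.m*n≢0 H 2
  Mℚ = toℚ (+ M)
  ε = + 1 ℚ./ M
  0<ε : 0ℚ ℚ.< ε
  0<ε = ℚP.positive⁻¹ ε {{ℚP.normalize-pos 1 M}}
  εM : ε ℚ.* Mℚ ≡ 1ℚ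
  εM = /-*-cancel (+ 1) M
  0≤Mℚ : 0ℚ ℚ.≤ Mℚ
  0≤Mℚ = toℚ-mono-≤ {0ℤ} {+ M} (ℤ.+≤+ z≤n)

  -- The integers by which `ι x` differs from Q - f/2 and `Q x` from the real polynomial.
  k₁ k₂ : Cube n → ℤ
  k₁ x = proj₁ (proj₂ (proj₂ (rep x)))
  k₂ x = proj₁ (Q≈P x)

  good : Eventually (λ m →
    (∀ x → ℚ.∣ seq (ι x) m ∣ ℚ.≤ seq ε₀ m ℚ.+ ε) ×
    (∀ x → ℚ.∣ seq (ι x) m ℚ.- seq (Q x - ½bit (f x) + fromℤ (k₁ x)) m ∣ ℚ.≤ ε) ×
    (∀ x → ℚ.∣ seq (Q x) m ℚ.- seq (polynomial d P x + fromℤ (k₂ x)) m ∣ ℚ.≤ ε) ×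
    (∀ S → ℚ.∣ seq (P (initial n (card S))) m ℚ.- seq (P S) m ∣ ℚ.≤ ε))
  good = map₂ (λ h m N≤m x → ℚP.≤-trans (∣∣≤seq-∣∣ (ι x) m)
             (ℚP.≤-trans (≤-maxCube (λ x → ∣ ι x ∣) x m) (h m N≤m))) (bound ε 0<ε)
    ∧ᴱ (eventually-cube (λ x → ≃⇒close {ι x} {Q x - ½bit (f x) + fromℤ (k₁ x)} ε 0<ε
          (proj₂ (proj₂ (proj₂ (rep x)))))
    ∧ᴱ (eventually-cube (λ x → ≃⇒close {Q x} {polynomial d P x + fromℤ (k₂ x)} ε 0<ε
          (proj₂ (Q≈P x)))
    ∧ᴱ eventually-cube (λ S → ≃⇒close {P (initial n (card S))} {P S} ε 0<ε
          (P-sym (initial n (card S)) S (card-initial n (card S) (SubsetP.∣p∣≤n S))))))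

  m = proj₁ good
  ι≤ = proj₁ (proj₂ good m ℕP.≤-refl)
  ι-Q = proj₁ (proj₂ (proj₂ good m ℕP.≤-refl))
  Q-P = proj₁ (proj₂ (proj₂ (proj₂ good m ℕP.≤-refl)))
  P-P = proj₂ (proj₂ (proj₂ (proj₂ good m ℕP.≤-refl)))

  -- Only the coefficient of one standard set of each size is rounded. Symmetry carries the
  -- approximation over to the other sets of that size.
  b : ℕ → ℤ
  b k = ℚ.floor (Mℚ ℚ.* seq (P (initial n k)) m)

  -- The bound 2 is 1 for rounding down plus 1 for replacing the standard set by `S`, which costs
  -- `ε` before scaling by `M`.
  b-close : ∀ S → ℚ.∣ toℚ (b (card S)) ℚ.- Mℚ ℚ.* seq (P S) m ∣ ℚ.≤ toℚ (+ 2)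
  b-close S = ∣∣-cong-≤
    (solve 4 (λ c M u v → (c :- M :* v) :+ (v :- u) :* M := c :- M :* u) refl
      (toℚ (b (card S))) Mℚ (seq (P S) m) v)
    (subst (ℚ.∣ (toℚ (b (card S)) ℚ.- Mℚ ℚ.* v) ℚ.+ (v ℚ.- seq (P S) m) ℚ.* Mℚ ∣ ℚ.≤_)
      (trans (cong (1ℚ ℚ.+_) εM) (sym (toℚ-+ 1ℤ 1ℤ)))
      (∣+∣≤ {toℚ (b (card S)) ℚ.- Mℚ ℚ.* v} {(v ℚ.- seq (P S) m) ℚ.* Mℚ}
        (floor-close (Mℚ ℚ.* v))
        (∣*∣≤ {v ℚ.- seq (P S) m} {Mℚ} (P-P S) (ℚP.≤-reflexive (ℚP.0≤p⇒∣p∣≡p 0≤Mℚ)))))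
    where
    open ℚS.+-*-Solver
    v = seq (P (initial n (card S))) m

  close-at : ∀ x → Near N M (M ℕ.+ N ℕ.* (3 ℕ.+ L ℕ.* 2))
    (polynomialℤ d b x ℤ.- + (H ℕ.* bit (f x)))
  close-at x = near k (ℤP.drop‿+≤+ (toℚ-cancel-≤ (begin
    toℚ (+ (N ℕ.* ℤ.∣ e ∣))
      ≡⟨ trans (cong toℚ (trans (ℤP.pos-* N ℤ.∣ e ∣) (ℤP.*-comm (+ N) _)))
               (toℚ-* (+ ℤ.∣ e ∣) (+ N)) ⟩
    toℚ (+ ℤ.∣ e ∣) ℚ.* Nℚ
      ≡⟨ cong (ℚ._* Nℚ) (sym (toℚ-∣∣ e)) ⟩
    ℚ.∣ toℚ e ∣ ℚ.* Nℚ
      ≤⟨ ℚP.*-monoʳ-≤-nonNeg Nℚ {{ℚ.nonNegative 0≤Nℚ}} e-close ⟩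
    (toℚ (+ (L ℕ.* 2)) ℚ.+ (((r ℚ.+ ε) ℚ.+ ε) ℚ.+ ε) ℚ.* Mℚ) ℚ.* Nℚ
      -- Since r N = 1 and ε M = 1, the approximation error contributes `M`, the three readings at
      -- index `m` contribute 3 N, and the rounding of `L` coefficients contributes 2 L N.
      ≡⟨ solve 5 (λ l r ε M N →
           (l :+ (((r :+ ε) :+ ε) :+ ε) :* M) :* N :=
           (r :* N) :* M :+ N :* ((ε :* M :+ (ε :* M :+ ε :* M)) :+ l)) refl
           (toℚ (+ (L ℕ.* 2))) r ε Mℚ Nℚ ⟩
    (r ℚ.* Nℚ) ℚ.* Mℚ ℚ.+ Nℚ ℚ.* ((ε ℚ.* Mℚ ℚ.+ (ε ℚ.* Mℚ ℚ.+ ε ℚ.* Mℚ)) ℚ.+ toℚ (+ (L ℕ.* 2)))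
      ≡⟨ cong₂ (λ s t → s ℚ.* Mℚ ℚ.+ Nℚ ℚ.* ((t ℚ.+ (t ℚ.+ t)) ℚ.+ toℚ (+ (L ℕ.* 2))))
           (ε₀N m) εM ⟩
    1ℚ ℚ.* Mℚ ℚ.+ Nℚ ℚ.* (toℚ (+ 3) ℚ.+ toℚ (+ (L ℕ.* 2)))
      ≡⟨ cong₂ ℚ._+_ (ℚP.*-identityˡ Mℚ)
           (trans (cong (Nℚ ℚ.*_) (sym (toℚ-+ (+ 3) (+ (L ℕ.* 2)))))
             (trans (sym (toℚ-* (+ N) (+ (3 ℕ.+ L ℕ.* 2))))
               (cong toℚ (sym (ℤP.pos-* N (3 ℕ.+ L ℕ.* 2)))))) ⟩
    Mℚ ℚ.+ toℚ (+ (N ℕ.* (3 ℕ.+ L ℕ.* 2)))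
      ≡⟨ sym (toℚ-+ (+ M) (+ (N ℕ.* (3 ℕ.+ L ℕ.* 2)))) ⟩
    toℚ (+ (M ℕ.+ N ℕ.* (3 ℕ.+ L ℕ.* 2))) ∎)))
    where
    open ℚP.≤-Reasoning
    open ℚS.+-*-Solver
    -- Near the limit, `ι x` is the polynomial minus f/2 plus `k₁ x` plus `k₂ x`. Scaling by M = 2 H
    -- turns f/2 into H f and the integers into multiples of `M`.
    k = ℤ.- (k₁ x ℤ.+ k₂ x)
    p = polynomialℤ d b x
    e = (p ℤ.- + (H ℕ.* bit (f x))) ℤ.- k ℤ.* + M
    r = seq ε₀ m
    Nℚ = toℚ (+ N)
    0≤Nℚ : 0ℚ ℚ.≤ Nℚ
    0≤Nℚ = toℚ-mono-≤ {0ℤ} {+ N} (ℤ.+≤+ z≤n)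
    h = + bit (f x) ℚ./ 2
    y = seq (polynomial d P x) m
    q = seq (Q x) m
    i = seq (ι x) m
    κ₁ = toℚ (k₁ x)
    κ₂ = toℚ (k₂ x)

    half : toℚ (+ (H ℕ.* bit (f x))) ≡ h ℚ.* Mℚ
    half = trans (cong toℚ (ℤP.pos-* H (bit (f x)))) (trans (toℚ-* (+ H) (+ bit (f x)))
      (trans (cong (toℚ (+ H) ℚ.*_) (sym (/-*-cancel (+ bit (f x)) 2)))
        (trans (solve 3 (λ a h t → a :* (h :* t) := h :* (a :* t)) refl (toℚ (+ H)) h (toℚ (+ 2)))
          (cong (h ℚ.*_) (trans (sym (toℚ-* (+ H) (+ 2))) (cong toℚ (sym (ℤP.pos-* H 2))))))))

    toℚ-e : toℚ e ≡ (toℚ p ℚ.- h ℚ.* Mℚ) ℚ.+ (κ₁ ℚ.+ κ₂) ℚ.* Mℚ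
    toℚ-e = trans (cong toℚ (ℤSolve p (+ (H ℕ.* bit (f x))) (k₁ x) (k₂ x) (+ M)))
      (trans (toℚ-+ (p ℤ.- + (H ℕ.* bit (f x))) _) (cong₂ ℚ._+_
        (trans (toℚ-+ p _) (cong (toℚ p ℚ.+_)
          (trans (toℚ-neg (+ (H ℕ.* bit (f x)))) (cong ℚ.-_ half))))
        (trans (toℚ-* (k₁ x ℤ.+ k₂ x) (+ M)) (cong (ℚ._* Mℚ) (toℚ-+ (k₁ x) (k₂ x))))))
      where
      ℤSolve : ∀ p h k l M → (p ℤ.- h) ℤ.- (ℤ.- (k ℤ.+ l)) ℤ.* M ≡ (p ℤ.- h) ℤ.+ (k ℤ.+ l) ℤ.* M
      ℤSolve = ℤsolve 5 (λ p h k l M →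
        (p ⊖ h) ⊖ (⊝ (k ⊕ l)) ⊗ M ≔ (p ⊖ h) ⊕ (k ⊕ l) ⊗ M) refl
        where open ℤS.+-*-Solver renaming
                (solve to ℤsolve; _:+_ to _⊕_; _:*_ to _⊗_; _:-_ to _⊖_; :-_ to ⊝_; _:=_ to _≔_)

    neg-≤ : ∀ {a s} → ℚ.∣ a ∣ ℚ.≤ s → ℚ.∣ ℚ.- a ∣ ℚ.≤ s
    neg-≤ {a} {s} = subst (ℚ._≤ s) (sym (ℚP.∣-p∣≡∣p∣ a))

    e-close : ℚ.∣ toℚ e ∣ ℚ.≤ toℚ (+ (L ℕ.* 2)) ℚ.+ (((r ℚ.+ ε) ℚ.+ ε) ℚ.+ ε) ℚ.* Mℚ
    e-close = ∣∣-cong-≤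
      -- Telescopes from `ι x` through Q and the real polynomial to the rounded one, leaving only
      -- quantities bounded by `good` and `∑-rounding`.
      (trans (solve 8 (λ p M y i q h κ₁ κ₂ →
          (p :- M :* y) :+ ((i :+ (:- (i :- ((q :+ (:- h)) :+ κ₁)))) :+ (:- (q :- (y :+ κ₂)))) :* M :=
          (p :- h :* M) :+ (κ₁ :+ κ₂) :* M) refl (toℚ p) Mℚ y i q h κ₁ κ₂)
        (sym toℚ-e))
      (∣+∣≤ {toℚ p ℚ.- Mℚ ℚ.* y}
        (∑-rounding Mℚ m 2 (support n d) (b ∘ card) P (λ S → monomial S x) b-close
          (λ S → monomial≤1 S x))
        (∣*∣≤ {(i ℚ.+ (ℚ.- (i ℚ.- ((q ℚ.+ (ℚ.- h)) ℚ.+ κ₁)))) ℚ.+ (ℚ.- (q ℚ.- (y ℚ.+ κ₂)))} {Mℚ}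
          (∣+∣≤ {i ℚ.+ (ℚ.- (i ℚ.- ((q ℚ.+ (ℚ.- h)) ℚ.+ κ₁)))}
            (∣+∣≤ {i} (ι≤ x) (neg-≤ {i ℚ.- ((q ℚ.+ (ℚ.- h)) ℚ.+ κ₁)} (ι-Q x)))
            (neg-≤ {q ℚ.- (y ℚ.+ κ₂)} (Q-P x)))
          (ℚP.≤-reflexive (ℚP.0≤p⇒∣p∣≡p 0≤Mℚ))))

-- Counting

1/20n-* : ∀ n (2≤n : 2 ℕ.≤ n) m → seq (1/20n n 2≤n) m ℚ.* toℚ (+ (20 ℕ.* n)) ≡ 1ℚ
1/20n-* n 2≤n m = /-*-cancel (+ 1) (20 ℕ.* n)
  {{ℕP.m*n≢0 20 n {{_}} {{ℕ.>-nonZero (ℕP.<⇒≤ 2≤n)}}}}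

-- Of the available 20 n H, the approximation errors use at most 4 n H because n + 1 is at most 2 n.
-- The remaining errors are at most 200 n (n+1)^(d+1), strictly below 256 n (n+1)^(d+1), which the
-- lower bound on `H` keeps within 16 n H.
error-small : ∀ n d H → 2 ℕ.≤ n → 16 ℕ.* suc n ℕ.^ suc d ℕ.≤ H →
  suc n ℕ.* (H ℕ.* 2 ℕ.+ 20 ℕ.* n ℕ.* (3 ℕ.+ List.length (support n d) ℕ.* 2)) ℕ.< 20 ℕ.* n ℕ.* H
error-small n d H 2≤n 16Z≤H = begin-strict
  suc n ℕ.* (H ℕ.* 2 ℕ.+ 20 ℕ.* n ℕ.* (3 ℕ.+ L ℕ.* 2))
    ≤⟨ ℕP.*-mono-≤ 1+n≤2n (ℕP.+-monoʳ-≤ (H ℕ.* 2) error≤) ⟩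
  (n ℕ.+ n) ℕ.* (H ℕ.* 2 ℕ.+ 100 ℕ.* Z)
    ≡⟨ solve 3 (λ n H Z → (n :+ n) :* (H :* con 2 :+ con 100 :* Z) :=
         n :* (con 4 :* H :+ con 200 :* Z)) refl n H Z ⟩
  n ℕ.* (4 ℕ.* H ℕ.+ 200 ℕ.* Z)
    <⟨ ℕP.*-monoʳ-< n {{ℕ.>-nonZero (ℕP.<⇒≤ 2≤n)}}
         (ℕP.+-monoʳ-< (4 ℕ.* H) (ℕP.*-monoˡ-< Z {{ℕP.m^n≢0 (suc n) (suc d)}} (ℕP.<ᵇ⇒< 200 256 _))) ⟩
  n ℕ.* (4 ℕ.* H ℕ.+ 256 ℕ.* Z)
    ≡⟨ solve 3 (λ n H Z → n :* (con 4 :* H :+ con 256 :* Z) :=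
         n :* (con 4 :* H :+ con 16 :* (con 16 :* Z))) refl n H Z ⟩
  n ℕ.* (4 ℕ.* H ℕ.+ 16 ℕ.* (16 ℕ.* Z))
    ≤⟨ ℕP.*-monoʳ-≤ n (ℕP.+-monoʳ-≤ (4 ℕ.* H) (ℕP.*-monoʳ-≤ 16 16Z≤H)) ⟩
  n ℕ.* (4 ℕ.* H ℕ.+ 16 ℕ.* H)
    ≡⟨ solve 2 (λ n H → n :* (con 4 :* H :+ con 16 :* H) := con 20 :* n :* H) refl n H ⟩
  20 ℕ.* n ℕ.* H ∎
  where
  open ℕP.≤-Reasoning
  open ℕS.+-*-Solver
  L = List.length (support n d)
  Z′ = suc n ℕ.^ d
  Z = suc n ℕ.^ suc d
  1+n≤2n : suc n ℕ.≤ n ℕ.+ n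
  1+n≤2n = ℕP.+-monoˡ-≤ n (ℕP.<⇒≤ 2≤n)
  error≤ : 20 ℕ.* n ℕ.* (3 ℕ.+ L ℕ.* 2) ℕ.≤ 100 ℕ.* Z
  error≤ = begin
    20 ℕ.* n ℕ.* (3 ℕ.+ L ℕ.* 2)
      ≤⟨ ℕP.*-mono-≤ (ℕP.*-monoʳ-≤ 20 (ℕP.n≤1+n n))
           (ℕP.+-mono-≤ (ℕP.*-monoʳ-≤ 3 (ℕP.m^n>0 (suc n) d)) (ℕP.*-monoˡ-≤ 2 (length-support n d))) ⟩
    20 ℕ.* suc n ℕ.* (3 ℕ.* Z′ ℕ.+ Z′ ℕ.* 2)
      ≡⟨ solve 2 (λ n Z′ → con 20 :* n :* (con 3 :* Z′ :+ Z′ :* con 2) := con 100 :* (n :* Z′)) refl (suc n) Z′ ⟩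
    100 ℕ.* Z ∎

-- With fewer vectors of d + 1 residues modulo 2 H than sets of weights, `bit-relation` would supply
-- a relation among the rounded polynomials. At a weight `v` with a nonzero coefficient,
-- `no-relation` then demands a larger total error than `error-small` permits.
residues-separate-subsets : ∀ n d H .{{_ : ℕ.NonZero H}} (2≤n : 2 ℕ.≤ n) → 16 ℕ.* suc n ℕ.^ suc d ℕ.≤ H →
  (∀ w → w ℕ.≤ n → Σ[ Q ∈ (Cube n → 𝕋) ]
    (IsSymmetricTorusPolynomial d Q × Q Approximates[ 1/20n n 2≤n ] Δ w)) →
  2 ℕ.^ suc n ℕ.≤ (H ℕ.* 2) ℕ.^ suc d
residues-separate-subsets n d H 2≤n 16Z≤H approximations = ℕP.≮⇒≥ λ few →
  let (E , E≤1 , (v , ∣Ev∣≡1) , relation) = bit-relation (suc n) (suc d) M few b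
  in ℕP.<⇒≱ (error-small n d H 2≤n 16Z≤H)
       (no-relation {n} {20 ℕ.* n} E value value-close E≤1 v ∣Ev∣≡1 (value-relation E v relation))
  where
  M = H ℕ.* 2
  L = List.length (support n d)
  instance
    _ : ℕ.NonZero M
    _ = ℕP.m*n≢0 H 2
    _ : ℕ.NonZero (20 ℕ.* n)
    _ = ℕP.m*n≢0 20 n {{_}} {{ℕ.>-nonZero (ℕP.<⇒≤ 2≤n)}}

  coefficients : ∀ w → w ℕ.≤ n → Σ[ b ∈ (ℕ → ℤ) ] (∀ x →
    Near (20 ℕ.* n) M (M ℕ.+ 20 ℕ.* n ℕ.* (3 ℕ.+ L ℕ.* 2))
      (polynomialℤ d b x ℤ.- + (H ℕ.* bit (Δ w x))))
  coefficients w w≤n = let (Q , symmetric , close) = approximations w w≤n in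
    integral-coefficients d H (20 ℕ.* n) (1/20n n 2≤n) (1/20n-* n 2≤n) (Δ w) Q symmetric close

  b : Fin (suc n) → ℕ → ℤ
  b w = proj₁ (coefficients (toℕ w) (FinP.toℕ≤pred[n] w))

  point : Fin (suc n) → Cube n
  point v = initial n (toℕ v)

  value : Fin (suc n) → Fin (suc n) → ℤ
  value w v = polynomialℤ d (b w) (point v)

  value-close : ∀ w v → Near (20 ℕ.* n) M (M ℕ.+ 20 ℕ.* n ℕ.* (3 ℕ.+ L ℕ.* 2))
    (value w v ℤ.- + (H ℕ.* δ v w))
  value-close w v = subst
    (λ k → Near (20 ℕ.* n) M (M ℕ.+ 20 ℕ.* n ℕ.* (3 ℕ.+ L ℕ.* 2))
      (value w v ℤ.- + (H ℕ.* bit (does (k ℕP.≟ toℕ w)))))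
    (weight-initial n (toℕ v) (FinP.toℕ≤pred[n] v))
    (proj₂ (coefficients (toℕ w) (FinP.toℕ≤pred[n] w)) (point v))

  -- Only sets of size at most `d` carry coefficients, so relations for the d + 1 sizes suffice at
  -- every point.
  value-relation : ∀ E v → (∀ k → k ℕ.< suc d → + M ∣ sum (λ w → E w ℤ.* b w k)) →
    + M ∣ sum (λ w → E w ℤ.* value w v)
  value-relation E v relation = subst (+ M ∣_)
    (∑ℤ-linear (support n d) E (λ w S → b w (card S)) (λ S → + monomial S (point v)))
    (∑ℤ-∣ _ (support-card n d) λ {S} card≤d →
      ℤD.∣m⇒∣m*n (+ monomial S (point v)) (relation (card S) (s≤s card≤d)))

counting-bound : ∀ n d (2≤n : 2 ℕ.≤ n) →
  (∀ w → w ℕ.≤ n → Σ[ Q ∈ (Cube n → 𝕋) ]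
    (IsSymmetricTorusPolynomial d Q × Q Approximates[ 1/20n n 2≤n ] Δ w)) →
  suc n ℕ.≤ (5 ℕ.+ suc ⌊log₂ n ⌋ ℕ.* suc d) ℕ.* suc d
counting-bound n d 2≤n approximations = ℕP.≮⇒≥ λ few → ℕP.<⇒≱ (ℕP.^-monoʳ-< 2 (s≤s (s≤s z≤n)) few)
  (subst (2 ℕ.^ suc n ℕ.≤_) M^[1+d]
    (residues-separate-subsets n d (2 ℕ.^ t) {{ℕP.m^n≢0 2 t}} 2≤n 16Z≤2^t approximations))
  where
  -- The choice H = 2 ^ t covers the factor 16 = 2 ^ 4 and, as n + 1 is at most 2 ^ (1 + ⌊log₂ n ⌋),
  -- also the power of n + 1. Doubling `H` to get `M` raises the 4 to the 5 of the statement.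
  t = 4 ℕ.+ suc ⌊log₂ n ⌋ ℕ.* suc d

  M^[1+d] : (2 ℕ.^ t ℕ.* 2) ℕ.^ suc d ≡ 2 ℕ.^ (suc t ℕ.* suc d)
  M^[1+d] = trans (cong (ℕ._^ suc d) (ℕP.*-comm (2 ℕ.^ t) 2)) (ℕP.^-*-assoc 2 (suc t) (suc d))

  16Z≤2^t : 16 ℕ.* suc n ℕ.^ suc d ℕ.≤ 2 ℕ.^ t
  16Z≤2^t = begin
    16 ℕ.* suc n ℕ.^ suc d
      ≤⟨ ℕP.*-monoʳ-≤ 16 (ℕP.^-monoˡ-≤ (suc d) (<2^suc⌊log₂⌋ n)) ⟩
    16 ℕ.* (2 ℕ.^ suc ⌊log₂ n ⌋) ℕ.^ suc d
      ≡⟨ cong (16 ℕ.*_) (ℕP.^-*-assoc 2 (suc ⌊log₂ n ⌋) (suc d)) ⟩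
    2 ℕ.^ 4 ℕ.* 2 ℕ.^ (suc ⌊log₂ n ⌋ ℕ.* suc d)
      ≡⟨ sym (ℕP.^-distribˡ-+-* 2 4 (suc ⌊log₂ n ⌋ ℕ.* suc d)) ⟩
    2 ℕ.^ t ∎
    where open ℕP.≤-Reasoning

-- As `d` and `l` are positive, 5 is at most 5 d l, and 1 + l and 1 + d are at most 2 l and 2 d,
-- which gives 18 d² l. The constant is raised to the square 25 so that a root can be taken.
n≤25d²log : ∀ n d l → 1 ℕ.≤ d → 1 ℕ.≤ l → suc n ℕ.≤ (5 ℕ.+ suc l ℕ.* suc d) ℕ.* suc d →
  n ℕ.≤ (5 ℕ.* d) ℕ.* (5 ℕ.* d) ℕ.* l
n≤25d²log n d l 1≤d 1≤l h = begin
  n                                                        ≤⟨ ℕP.n≤1+n n ⟩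
  suc n                                                    ≤⟨ h ⟩
  (5 ℕ.+ suc l ℕ.* suc d) ℕ.* suc d
    ≤⟨ ℕP.*-mono-≤ (ℕP.+-mono-≤ (ℕP.*-monoʳ-≤ 5 (ℕP.*-mono-≤ 1≤d 1≤l))
         (ℕP.*-mono-≤ (ℕP.+-monoˡ-≤ l 1≤l) (ℕP.+-monoˡ-≤ d 1≤d))) (ℕP.+-monoˡ-≤ d 1≤d) ⟩
  (5 ℕ.* (d ℕ.* l) ℕ.+ (l ℕ.+ l) ℕ.* (d ℕ.+ d)) ℕ.* (d ℕ.+ d)
    ≡⟨ solve 2 (λ d l → (con 5 :* (d :* l) :+ (l :+ l) :* (d :+ d)) :* (d :+ d) :=
         con 18 :* (d :* d :* l)) refl d l ⟩
  18 ℕ.* (d ℕ.* d ℕ.* l)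
    ≤⟨ ℕP.*-monoˡ-≤ (d ℕ.* d ℕ.* l) (ℕP.≤ᵇ⇒≤ 18 25 _) ⟩
  25 ℕ.* (d ℕ.* d ℕ.* l)
    ≡⟨ solve 2 (λ d l → con 25 :* (d :* d :* l) := (con 5 :* d) :* (con 5 :* d) :* l) refl d l ⟩
  (5 ℕ.* d) ℕ.* (5 ℕ.* d) ℕ.* l ∎
  where
  open ℕP.≤-Reasoning
  open ℕS.+-*-Solver

-- Comparison with the real logarithm and square root

-- Raising 2 ^ l ≤ n to the power k + 1 bounds every approximant from below, not only the limit.
⌊log₂⌋≤log₂ : ∀ n .{{_ : ℕ.NonZero n}} k → toℚ (+ ⌊log₂ n ⌋) ℚ.≤ seq (log₂ n) k
⌊log₂⌋≤log₂ n k = /-mono-≤ l ⌊log₂ n ℕ.^ suc k ⌋ 0 k (begin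
  l ℕ.* suc k                       ≡⟨ sym (⌊log₂[2^n]⌋≡n (l ℕ.* suc k)) ⟩
  ⌊log₂ 2 ℕ.^ (l ℕ.* suc k) ⌋       ≡⟨ cong ⌊log₂_⌋ (sym (ℕP.^-*-assoc 2 l (suc k))) ⟩
  ⌊log₂ (2 ℕ.^ l) ℕ.^ suc k ⌋       ≤⟨ ⌊log₂⌋-mono-≤ (ℕP.^-monoˡ-≤ (suc k) (2^⌊log₂⌋≤ n)) ⟩
  ⌊log₂ n ℕ.^ suc k ⌋               ≡⟨ sym (ℕP.*-identityʳ _) ⟩
  ⌊log₂ n ℕ.^ suc k ⌋ ℕ.* 1         ∎)
  where
  open ℕP.≤-Reasoning
  l = ⌊log₂ n ⌋

*-1/⁺-≤ : ∀ {a b D} (0<D : 0ℚ ℚ.< D) → a ℚ.≤ b ℚ.* D → a ℚ.* 1/⁺ 0<D ℚ.≤ b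
*-1/⁺-≤ {a} {b} {D} 0<D h = ℚP.*-cancelʳ-≤-pos D {{ℚ.positive 0<D}}
  (subst (ℚ._≤ b ℚ.* D) (sym (÷⁺-* a 0<D)) h)

-- The approximants of a root are rounded down, so a rational upper bound for the root bounds each
-- of them.
√ℚ-≤ : ∀ q k r → 0ℚ ℚ.≤ q → 0ℚ ℚ.≤ r → q ℚ.≤ r ℚ.* r → √ℚ q k ℚ.≤ r
√ℚ-≤ q k r 0≤q 0≤r q≤r² = ℚP.≮⇒≥ λ r<√q → ℚP.<-irrefl refl (begin-strict
  r ℚ.* r              ≤⟨ ℚP.*-monoˡ-≤-nonNeg r {{ℚ.nonNegative 0≤r}} (ℚP.<⇒≤ r<√q) ⟩
  r ℚ.* √ℚ q k         <⟨ ℚP.*-monoˡ-<-pos (√ℚ q k) {{ℚ.positive (ℚP.≤-<-trans 0≤r r<√q)}} r<√q ⟩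
  √ℚ q k ℚ.* √ℚ q k    ≤⟨ √ℚ-lower q k 0≤q ⟩
  q                    ≤⟨ q≤r² ⟩
  r ℚ.* r              ∎)
  where open ℚP.≤-Reasoning

√[n/log₂]-≤ : ∀ n d (2≤n : 2 ℕ.≤ n) → n ℕ.≤ d ℕ.* d ℕ.* ⌊log₂ n ⌋ →
  ∀ k → seq (√ (fromℕ n / log₂ n [ log₂-pos 2≤n ])) k ℚ.≤ toℚ (+ d)
√[n/log₂]-≤ n d 2≤n n≤d²l k = √ℚ-≤ (x ℚ.⊔ 0ℚ) k (toℚ (+ d)) (ℚP.p≤q⊔p x 0ℚ) 0≤d
  -- The second bound is for the truncation at zero inside `√_`.
  (ℚP.⊔-lub (*-1/⁺-≤ 0<D n≤d²D) (subst (0ℚ ℚ.≤_) d² (toℚ-mono-≤ {0ℤ} {+ (d ℕ.* d)} (ℤ.+≤+ z≤n))))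
  where
  open ℚP.≤-Reasoning
  instance
    _ : ℕ.NonZero n
    _ = ℕ.>-nonZero (ℕP.<⇒≤ 2≤n)
  x = seq (fromℕ n / log₂ n [ log₂-pos 2≤n ]) k
  -- This is the denominator `recip` inverts, with the positive lower bound 1 supplied by
  -- `log₂-pos`.
  D = seq (log₂ n) k ℚ.⊔ 1ℚ
  0<D : 0ℚ ℚ.< D
  0<D = ⊔-pos (seq (log₂ n) k) (ℚP.positive⁻¹ 1ℚ)
  0≤d : 0ℚ ℚ.≤ toℚ (+ d)
  0≤d = toℚ-mono-≤ {0ℤ} {+ d} (ℤ.+≤+ z≤n)
  d² : toℚ (+ (d ℕ.* d)) ≡ toℚ (+ d) ℚ.* toℚ (+ d)
  d² = trans (cong toℚ (ℤP.pos-* d d)) (toℚ-* (+ d) (+ d))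
  n≤d²D : toℚ (+ n) ℚ.≤ toℚ (+ d) ℚ.* toℚ (+ d) ℚ.* D
  n≤d²D = begin
    toℚ (+ n)
      ≤⟨ toℚ-mono-≤ (ℤ.+≤+ n≤d²l) ⟩
    toℚ (+ (d ℕ.* d ℕ.* ⌊log₂ n ⌋))
      ≡⟨ trans (cong toℚ (ℤP.pos-* (d ℕ.* d) ⌊log₂ n ⌋)) (toℚ-* (+ (d ℕ.* d)) (+ ⌊log₂ n ⌋)) ⟩
    toℚ (+ (d ℕ.* d)) ℚ.* toℚ (+ ⌊log₂ n ⌋)
      ≤⟨ ℚP.*-monoˡ-≤-nonNeg (toℚ (+ (d ℕ.* d)))
           {{ℚ.nonNegative (toℚ-mono-≤ {0ℤ} {+ (d ℕ.* d)} (ℤ.+≤+ z≤n))}}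
           (ℚP.≤-trans (⌊log₂⌋≤log₂ n k) (ℚP.p≤p⊔q (seq (log₂ n) k) 1ℚ)) ⟩
    toℚ (+ (d ℕ.* d)) ℚ.* D
      ≡⟨ cong (ℚ._* D) d² ⟩
    toℚ (+ d) ℚ.* toℚ (+ d) ℚ.* D ∎

lemma3p1 : Σ[ c ∈ ℝ ] (0ℝ < c ×
    (∀ (n d : ℕ) (2≤n : 2 ℕ.≤ n) → 1 ℕ.≤ d →
    (∀ (w : ℕ) → w ℕ.≤ n →
    Σ[ Q ∈ (Cube n → 𝕋) ]
    (IsSymmetricTorusPolynomial d Q × Q Approximates[ 1/20n n 2≤n ] Δ w)) →
    c * √ (fromℕ n / log₂ n [ log₂-pos 2≤n ]) ≤ fromℕ d))
lemma3p1 = fromℚ ⅕ , (⅕ , ℚP.positive⁻¹ ⅕ , 0 , λ _ _ → ℚP.≤-reflexive (ℚP.+-identityˡ ⅕)) ,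
  λ n d 2≤n 1≤d approximations ε 0<ε → 0 , λ k _ → begin
    ⅕ ℚ.* seq (√ (fromℕ n / log₂ n [ log₂-pos 2≤n ])) k
      ≤⟨ ℚP.*-monoˡ-≤-nonNeg ⅕ (√[n/log₂]-≤ n (5 ℕ.* d) 2≤n
           (n≤25d²log n d ⌊log₂ n ⌋ 1≤d (⌊log₂⌋-mono-≤ 2≤n) (counting-bound n d 2≤n approximations)) k) ⟩
    ⅕ ℚ.* toℚ (+ (5 ℕ.* d))
      ≡⟨ cong (ℚ._*_ ⅕) (trans (cong toℚ (ℤP.pos-* 5 d)) (toℚ-* (+ 5) (+ d))) ⟩
    ⅕ ℚ.* (toℚ (+ 5) ℚ.* toℚ (+ d))
      ≡⟨ trans (sym (ℚP.*-assoc ⅕ (toℚ (+ 5)) (toℚ (+ d)))) (ℚP.*-identityˡ (toℚ (+ d))) ⟩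
    toℚ (+ d)
      ≤⟨ ≤+nonNeg (toℚ (+ d)) (ℚP.<⇒≤ 0<ε) ⟩
    toℚ (+ d) ℚ.+ ε ∎
  where
  open ℚP.≤-Reasoning
  -- The constant cancels the 5 in the bound 5 d for the root.
  ⅕ = + 1 ℚ./ 5
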